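{- The $k$-Anti-Path Cover problem admits an FPT algorithm with respect to parameterization by the tree-depth of the input graph.
   Context: The $k$-Anti-Path Cover problem: given a graph $G$ and a positive integer $k$, decide whether the complement of $G$ is $k$-path coverable, i.e. whether the vertices of the complement $\overline{G}$ can be covered by at most $k$ vertex-disjoint paths in $\overline{G}$ (each vertex belongs to exactly one path). The tree-depth of $G$ is one more than the minimum height of a rooted forest $F$ such that $G$ is a subgraph of the closure of $F$ (the graph obtained from $F$ by making every vertex adjacent to all its ancestors). FPT means fixed-parameter tractable, i.e. solvable in time $f(d)\cdot n^{O(1)}$ for some computable function $f$, where $d$ is the tree-depth and $n$ the number of vertices. -}

module Defs where

open import Data.Bool using (Bool; true; false; not; _∧_; if_then_else_)
open import Data.Fin using (Fin)
open import Data.Fin.Properties using (_≟_)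
open import Data.List using (List; []; _∷_; length; map; allFin; replicate)
open import Data.List.Extrema.Nat using (max)
open import Data.List.Membership.Propositional using (_∈_)
open import Data.List.Relation.Binary.Disjoint.Propositional using (Disjoint)
open import Data.List.Relation.Unary.All using (All)
open import Data.List.Relation.Unary.AllPairs using (AllPairs)
open import Data.List.Relation.Unary.Any using (Any)
open import Data.List.Relation.Unary.Linked using (Linked)
open import Data.List.Relation.Unary.Unique.Propositional using (Unique)
open import Data.Maybe using (Maybe; just; nothing)
open import Data.Nat using (ℕ; suc; _+_; _*_; _^_; _≤_; _≡ᵇ_; NonZero)
open import Data.Product using (Σ-syntax; ∃-syntax; _×_)
open import Data.Sum using (_⊎_)
open import Function using (_∘_; _⇔_)
open import Function.Definitions using (Injective)
open import Relation.Binary.Construct.Closure.Transitive using (TransClosure)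
open import Relation.Binary.PropositionalEquality
  using (_≡_; _≢_; refl; sym; cong₂)
open import Relation.Nullary using (yes; no; contradiction)
open import Relation.Nullary.Decidable using (⌊_⌋)

------------------------------------------------------------------------
-- Finite simple graphs

record Graph (n : ℕ) : Set where
  field
    adj       : Fin n → Fin n → Bool
    symmetric : ∀ u v → adj u v ≡ adj v u
    loopless  : ∀ v → adj v v ≡ false

  Adjacent : Fin n → Fin n → Set
  Adjacent u v = adj u v ≡ true

distinct : ∀ {n} → Fin n → Fin n → Bool
distinct u v = not ⌊ u ≟ v ⌋

distinct-sym : ∀ {n} (u v : Fin n) → distinct u v ≡ distinct v u
distinct-sym u v with u ≟ v | v ≟ u
... | yes _   | yes _   = refl
... | no  _   | no  _   = refl
... | yes u≡v | no  v≢u = contradiction (sym u≡v) v≢u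
... | no  u≢v | yes v≡u = contradiction (sym v≡u) u≢v

distinct-irrefl : ∀ {n} (v : Fin n) → distinct v v ≡ false
distinct-irrefl v with v ≟ v
... | yes _   = refl
... | no  v≢v = contradiction refl v≢v

complement : ∀ {n} → Graph n → Graph n
complement G = record
  { adj       = λ u v → distinct u v ∧ not (adj u v)
  ; symmetric = λ u v → cong₂ (λ a b → a ∧ not b) (distinct-sym u v) (symmetric u v)
  ; loopless  = λ v → cong₂ (λ a b → a ∧ not b) (distinct-irrefl v) (loopless v)
  }
  where open Graph G

------------------------------------------------------------------------
-- Path covers

record IsPath {n} (G : Graph n) (p : List (Fin n)) : Set where
  field
    nonEmpty    : p ≢ []
    consecutive : Linked (Graph.Adjacent G) p
    simple      : Unique p

PathCoverable : ∀ {n} → ℕ → Graph n → Set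
PathCoverable {n} k G = ∃[ ps ]
    All (IsPath G) ps
  × AllPairs Disjoint ps
  × (∀ (v : Fin n) → Any (v ∈_) ps)
  × length ps ≤ k

------------------------------------------------------------------------
-- Tree-depth

-- A parent function on a finite set admits a function `depth` as below
-- exactly when it is acyclic, and `depth` is then unique: the number of
-- edges between a vertex and its root.
record RootedForest (m : ℕ) : Set where
  field
    parent      : Fin m → Maybe (Fin m)
    depth       : Fin m → ℕ
    depth-root  : ∀ {v} → parent v ≡ nothing → depth v ≡ 0
    depth-child : ∀ {u v} → parent v ≡ just u → depth v ≡ suc (depth u)

  IsParentOf : Fin m → Fin m → Set
  IsParentOf u v = parent v ≡ just u

  ProperAncestor : Fin m → Fin m → Set
  ProperAncestor = TransClosure IsParentOf

  -- The height is the maximal depth, and the empty forest has height -1.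
  height+1 : ℕ
  height+1 = max 0 (map (suc ∘ depth) (allFin m))

record SubgraphOfClosure {n m} (G : Graph n) (F : RootedForest m) : Set where
  open RootedForest F
  field
    ι           : Fin n → Fin m
    ι-injective : Injective _≡_ _≡_ ι
    ι-edge      : ∀ {u v} → Graph.Adjacent G u v →
                  ProperAncestor (ι u) (ι v) ⊎ ProperAncestor (ι v) (ι u)

HasTreeDepth : ∀ {n} → Graph n → ℕ → Set
HasTreeDepth G d =
    (∃[ m ] Σ[ F ∈ RootedForest m ]
       SubgraphOfClosure G F × RootedForest.height+1 F ≡ d)
  × (∀ m (F : RootedForest m) →
       SubgraphOfClosure G F → d ≤ RootedForest.height+1 F)

------------------------------------------------------------------------
-- Machine model: the language WHILE of N. D. Jones, "Computability and
-- Complexity from a Programming Perspective" (MIT Press, 1997), whose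
-- only data are binary trees, with unit cost per elementary operation.
-- Trees are shared pointers in an implementation, so that each operation
-- takes constant time, and the model is polynomially equivalent to Turing
-- machines and to RAMs with logarithmic cost.

infixr 5 _∙_
data Tree : Set where
  nil : Tree
  _∙_ : Tree → Tree → Tree

head tail : Tree → Tree
head nil     = nil
head (l ∙ r) = l
tail nil     = nil
tail (l ∙ r) = r

Variable : Set
Variable = ℕ

data Expr : Set where
  var   : Variable → Expr
  nil   : Expr
  cons  : Expr → Expr → Expr
  hd tl : Expr → Expr

infix  4 _≔_
infixr 3 _⨾_
data Command : Set where
  _≔_   : Variable → Expr → Command
  _⨾_   : Command → Command → Command
  cond  : Expr → Command → Command → Command
  while : Expr → Command → Command

Store : Set
Store = Variable → Tree

_[_↦_] : Store → Variable → Tree → Store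
(s [ x ↦ t ]) y = if x ≡ᵇ y then t else s y

eval : Expr → Store → Tree
eval (var x)    s = s x
eval nil        s = nil
eval (cons e f) s = eval e s ∙ eval f s
eval (hd e)     s = head (eval e s)
eval (tl e)     s = tail (eval e s)

cost : Expr → ℕ
cost (var x)    = 1
cost nil        = 1
cost (cons e f) = suc (cost e + cost f)
cost (hd e)     = suc (cost e)
cost (tl e)     = suc (cost e)

-- ⟨ C , s ⟩⇓⟨ t , s′ ⟩: started in store s, the command C halts in store s′
-- after t steps.  A test succeeds when its value is not nil.
infix 2 ⟨_,_⟩⇓⟨_,_⟩
data ⟨_,_⟩⇓⟨_,_⟩ : Command → Store → ℕ → Store → Set where
  assign : ∀ {x e s} →
           ⟨ x ≔ e , s ⟩⇓⟨ suc (cost e) , s [ x ↦ eval e s ] ⟩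
  seq    : ∀ {C D s s′ s″ t u} →
           ⟨ C , s ⟩⇓⟨ t , s′ ⟩ → ⟨ D , s′ ⟩⇓⟨ u , s″ ⟩ →
           ⟨ C ⨾ D , s ⟩⇓⟨ t + u , s″ ⟩
  then   : ∀ {e C D s s′ t} → eval e s ≢ nil →
           ⟨ C , s ⟩⇓⟨ t , s′ ⟩ →
           ⟨ cond e C D , s ⟩⇓⟨ suc (cost e + t) , s′ ⟩
  else   : ∀ {e C D s s′ t} → eval e s ≡ nil →
           ⟨ D , s ⟩⇓⟨ t , s′ ⟩ →
           ⟨ cond e C D , s ⟩⇓⟨ suc (cost e + t) , s′ ⟩
  stop   : ∀ {e C s} → eval e s ≡ nil →
           ⟨ while e C , s ⟩⇓⟨ suc (cost e) , s ⟩
  loop   : ∀ {e C s s′ s″ t u} → eval e s ≢ nil →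
           ⟨ C , s ⟩⇓⟨ t , s′ ⟩ → ⟨ while e C , s′ ⟩⇓⟨ u , s″ ⟩ →
           ⟨ while e C , s ⟩⇓⟨ suc (cost e + (t + u)) , s″ ⟩

-- Input and output are passed in variable 0, all others start as nil.
initial : Tree → Store
initial input = (λ _ → nil) [ 0 ↦ input ]

Computes_on_inTime_output_ : Command → Tree → ℕ → Tree → Set
Computes C on input inTime t output o =
  ∃[ s ] ⟨ C , initial input ⟩⇓⟨ t , s ⟩ × s 0 ≡ o

------------------------------------------------------------------------
-- Encodings

encodeBool : Bool → Tree
encodeBool false = nil
encodeBool true  = nil ∙ nil

encodeList : List Tree → Tree
encodeList []       = nil
encodeList (t ∷ ts) = t ∙ encodeList ts

encodeℕ : ℕ → Tree
encodeℕ n = encodeList (replicate n nil)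

-- The adjacency matrix, as the list of its rows.
encodeGraph : ∀ {n} → Graph n → Tree
encodeGraph {n} G =
  encodeList (map (λ u → encodeList (map (λ v → encodeBool (adj u v)) (allFin n)))
                  (allFin n))
  where open Graph G

------------------------------------------------------------------------
-- Fixed-parameter tractability

Computable : (ℕ → ℕ) → Set
Computable f = Σ[ C ∈ Command ] ∀ m →
  ∃[ t ] Computes C on encodeℕ m inTime t output encodeℕ (f m)

record ParameterizedProblem : Set₁ where
  field
    Instance     : Set
    encode       : Instance → Tree
    size         : Instance → ℕ
    HasParameter : Instance → ℕ → Set
    IsYes        : Instance → Set

-- The algorithm is not given the parameter, and has to halt with the
-- correct answer on every instance.  The successor makes the time bound
-- positive on instances of size 0; for n ≥ 1 the factor (1 + n)ᶜ ≤ 2ᶜ · nᶜ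
-- differs from nᶜ only by a constant, which f absorbs.
FixedParameterTractable : ParameterizedProblem → Set
FixedParameterTractable P =
  Σ[ C ∈ Command ] Σ[ f ∈ (ℕ → ℕ) ] Σ[ c ∈ ℕ ]
    Computable f
  × (∀ (i : Instance) →
       ∃[ t ] ∃[ b ]
         Computes C on encode i inTime t output encodeBool b
       × (b ≡ true ⇔ IsYes i)
       × (∀ d → HasParameter i d → t ≤ f d * suc (size i) ^ c))
  where open ParameterizedProblem P

------------------------------------------------------------------------
-- The problem

record GraphAndNumber : Set where
  field
    {n}          : ℕ
    graph        : Graph n
    k            : ℕ
    .{{k-nonZero}} : NonZero k

-- The size is the number of vertices only, so that writing k in unary
-- gives the algorithm no additional time.
AntiPathCoverByTreeDepth : ParameterizedProblem
AntiPathCoverByTreeDepth = record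
  { Instance     = GraphAndNumber
  ; encode       = λ i → encodeGraph (graph i) ∙ encodeℕ (k i)
  ; size         = n
  ; HasParameter = λ i → HasTreeDepth (graph i)
  ; IsYes        = λ i → PathCoverable (k i) (complement (graph i))
  }
  where open GraphAndNumber

module Submission where

-- Let H consist of the vertices of degree at least n/2 and let G′ be obtained from
-- G by deleting all edges with no end in H.  The complement of G is covered by k paths iff
-- the vertices can be ordered with fewer than k breaks, i.e. pairs of consecutive
-- vertices that are adjacent in G.
--
-- Counting breaks in G′ instead of G makes no difference: for a break (u , v) with
-- u , v ∉ H, deg u + deg v < n allows to remove it by reversing a segment of the
-- ordering, as in the closure theorem of Bondy and Chvátal.  Of more than 3|H|
-- twins of G′, one has no neighbour in H in the ordering, and it can be deleted;
-- conversely a vertex can be inserted next to a twin.  Hence 3|H| + 1 vertices of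
-- each class of twins suffice, and the orderings of this kernel are enumerated.
--
-- A graph of tree-depth d has at most n d edges, so that |H| ≤ 4d, and the kernel
-- has at most |H| + 2^|H| (3|H| + 1) vertices.
--
-- The algorithm is written in a language of folds over trees, which is compiled to
-- WHILE.  If all folds of a program run over at most N elements, then its time is
-- bounded by a polynomial in N.

open import Defs
open import Data.Bool using (Bool; true; false; T; if_then_else_; not; _∧_; _∨_; _xor_)
open import Data.Bool.ListAction using (all; any)
open import Data.Bool.Properties using (T-≡; T?; ∨-comm)
open import Data.Empty using (⊥-elim)
open import Data.Fin using (Fin; zero; suc; toℕ)
open import Data.Fin.Properties using (toℕ<n; toℕ-injective) renaming (_≟_ to _≟ᶠ_)
open import Data.List using (List; []; _∷_; _++_; _ʳ++_; length; map; replicate; drop; reverse; foldr; filter; concat; allFin; tabulate)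
open import Data.List.Extrema.Nat using (xs≤max)
open import Data.List.Membership.DecPropositional using (_∈?_)
open import Data.List.Membership.Propositional using (_∈_; find; lose)
open import Data.List.Membership.Propositional.Properties using (∈-allFin; ∈-map⁺; ∈-map⁻; ∈-filter⁺; ∈-filter⁻; ∈-concat⁺; ∈-concat⁻; ∈-∃++)
open import Data.List.Properties using (map-tabulate; length-map; length-replicate; length-tabulate; length-++; length-ʳ++; ++-identityʳ; ʳ++-ʳ++; ʳ++-defn; unfold-reverse; reverse-involutive)
open import Data.List.Relation.Binary.Disjoint.Propositional using (Disjoint)
open import Data.List.Relation.Binary.Permutation.Propositional as ↭ using (_↭_; prep; swap; ↭-refl; ↭-sym; ↭-trans; ↭-reflexive)
open import Data.List.Relation.Binary.Permutation.Propositional.Properties using (∈-resp-↭; ↭-length; ↭-reverse; ++⁺ˡ; ++↭ʳ++; shift; drop-∷)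
open import Data.List.Relation.Unary.All as All using (All; []; _∷_)
import Data.List.Relation.Unary.All.Properties as All
open import Data.List.Relation.Unary.AllPairs using (AllPairs; []; _∷_)
open import Data.List.Relation.Unary.Any using (here; there)
open import Data.List.Relation.Unary.Any.Properties using (any⁺; any⁻)
open import Data.List.Relation.Unary.Linked using (Linked; []; [-]; _∷_)
open import Data.List.Relation.Unary.Unique.Propositional using (Unique)
open import Data.List.Relation.Unary.Unique.Propositional.Properties using (allFin⁺; filter⁺) renaming (concat⁺ to Unique-concat; map⁺ to Unique-map)
open import Data.Maybe using (just; nothing)
open import Data.Nat hiding (_≟_; equal; less; greater)
open import Data.Nat.ListAction using (sum)
open import Data.Nat.Properties hiding (_≟_)
open import Data.Nat.Tactic.RingSolver using (solve-∀)
open import Data.Product using (_×_; _,_; proj₁; proj₂; ∃-syntax)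
open import Data.Sum using (_⊎_; inj₁; inj₂)
open import Data.Unit using (⊤; tt)
open import Function using (_∘_; id; Equivalence; _⇔_; mk⇔)
open import Relation.Binary.Construct.Closure.Transitive using ([_]; _∷_)
open import Relation.Binary.PropositionalEquality
open import Relation.Nullary using (yes; no; contradiction)
open import Relation.Nullary.Decidable using (⌊_⌋; toWitness; fromWitness)

-- For `u` and `v` adjacent in G, deg u + deg v < n says that their degrees in the complement add up
-- to at least n - 1, the condition under which joining them there does not change the number of
-- paths required. This is where n/2 comes from. As H is defined by degrees alone, the program needs
-- neither the tree-depth nor a forest; d enters only into the analysis of its time. The factor 3
-- accounts, for each vertex of H, for the vertex itself and its two neighbours in an ordering: the
-- positions at which no deletion of a twin is claimed.
--
-- Two features of the problem shape the program. The number k is written in unary and can be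
-- arbitrarily large compared with n, so no loop may run over it; it is only shortened by one cell
-- per break. And the machine model asks for an exact number of steps, which the compiler supplies
-- once and for all, so that only lengths of lists remain to be bounded.

infixr 9 _after_

-- A language of folds over trees and its compilation to WHILE

data Fn : Set where
  input leaf : Fn
  pair       : Fn → Fn → Fn
  left right : Fn → Fn
  branch     : Fn → Fn → Fn → Fn
  _after_    : Fn → Fn → Fn
  fold       : Fn → Fn → Fn → Fn

truth : Tree → Bool
truth nil     = false
truth (_ ∙ _) = true

foldTree : (Tree → Tree → Tree) → Tree → Tree → Tree
foldTree h a nil      = a
foldTree h a (x ∙ xs) = h (foldTree h a xs) x

-- The step of a fold sees the single tree `t ∙ acc ∙ x`; passing the outer input `t` along takes
-- the place of variables. With folds as the only recursion, every program halts.
⟦_⟧ : Fn → Tree → Tree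
⟦ input ⟧        t = t
⟦ leaf ⟧         t = nil
⟦ pair f g ⟧     t = ⟦ f ⟧ t ∙ ⟦ g ⟧ t
⟦ left f ⟧       t = head (⟦ f ⟧ t)
⟦ right f ⟧      t = tail (⟦ f ⟧ t)
⟦ branch c f g ⟧ t = if truth (⟦ c ⟧ t) then ⟦ f ⟧ t else ⟦ g ⟧ t
⟦ f after g ⟧    t = ⟦ f ⟧ (⟦ g ⟧ t)
⟦ fold g a l ⟧   t = foldTree (λ acc x → ⟦ g ⟧ (t ∙ acc ∙ x)) (⟦ a ⟧ t) (⟦ l ⟧ t)

-- `run f b` works in place on variable b and only changes variables from b on.
-- The while-loops of a fold traverse the reversal of the list, so that the
-- fold associates to the right.
run : Fn → Variable → Command
reverseLoop : Variable → Command
foldLoop : Fn → Variable → Command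

run input          b = b ≔ var b
run leaf           b = b ≔ nil
run (pair f g)     b = (1 + b ≔ var b ⨾ run f (1 + b)) ⨾ (2 + b ≔ var b ⨾ run g (2 + b))
                     ⨾ b ≔ cons (var (1 + b)) (var (2 + b))
run (left f)       b = run f b ⨾ b ≔ hd (var b)
run (right f)      b = run f b ⨾ b ≔ tl (var b)
run (branch c f g) b = (1 + b ≔ var b ⨾ run c (1 + b)) ⨾ cond (var (1 + b)) (run f b) (run g b)
run (f after g)    b = run g b ⨾ run f b
run (fold g a l)   b = (1 + b ≔ var b ⨾ run a (1 + b)) ⨾ (2 + b ≔ var b ⨾ run l (2 + b))
                     ⨾ 3 + b ≔ nil ⨾ reverseLoop b ⨾ foldLoop g b ⨾ b ≔ var (1 + b)

reverseLoop b = while (var (2 + b))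
  (3 + b ≔ cons (hd (var (2 + b))) (var (3 + b)) ⨾ 2 + b ≔ tl (var (2 + b)))

foldLoop g b = while (var (3 + b))
  (4 + b ≔ cons (var b) (cons (var (1 + b)) (hd (var (3 + b)))) ⨾ run g (4 + b)
  ⨾ 1 + b ≔ var (4 + b) ⨾ 3 + b ≔ tl (var (3 + b)))

reverseOnto : Tree → Tree → Tree
reverseOnto nil      r = r
reverseOnto (x ∙ xs) r = reverseOnto xs (x ∙ r)

foldLeft : (Tree → Tree → Tree) → Tree → Tree → Tree
foldLeft h a nil      = a
foldLeft h a (x ∙ xs) = foldLeft h (h a x) xs

foldLeft-reverseOnto : ∀ h a xs r →
  foldLeft h a (reverseOnto xs r) ≡ foldLeft h (foldTree h a xs) r
foldLeft-reverseOnto h a nil      r = refl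
foldLeft-reverseOnto h a (x ∙ xs) r = foldLeft-reverseOnto h a xs (x ∙ r)

reverseTime : Tree → ℕ
reverseTime nil      = 2
reverseTime (_ ∙ xs) = 2 + (8 + reverseTime xs)

-- Exact, because the judgement ⇓ fixes the number of steps. The constants are the costs of the glue
-- in `run`: 2 for a copy or a test, 3 for `hd` or `tl` of a variable, 4 for `cons` of two
-- variables, 7 for packing the argument of a step.
time : Fn → Tree → ℕ
foldTime : Fn → Tree → Tree → Tree → ℕ

time input          t = 2
time leaf           t = 2
time (pair f g)     t = (2 + time f t) + ((2 + time g t) + 4)
time (left f)       t = time f t + 3
time (right f)      t = time f t + 3
time (branch c f g) t = (2 + time c t)
                      + (2 + (if truth (⟦ c ⟧ t) then time f t else time g t))
time (f after g)    t = time g t + time f (⟦ g ⟧ t)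
time (fold g a l)   t = (2 + time a t) + ((2 + time l t) + (2 +
  (reverseTime (⟦ l ⟧ t) + (foldTime g t (⟦ a ⟧ t) (reverseOnto (⟦ l ⟧ t) nil) + 2))))

foldTime g t a nil      = 2
foldTime g t a (x ∙ xs) =
  2 + ((7 + (time g (t ∙ a ∙ x) + 5)) + foldTime g t (⟦ g ⟧ (t ∙ a ∙ x)) xs)

-- Correctness and exact running time of compiled programs

update-same : ∀ s x t → (s [ x ↦ t ]) x ≡ t
update-same s zero    t = refl
update-same s (suc x) t = update-same (s ∘ suc) x t

update-below : ∀ s {x y} t → y < x → (s [ x ↦ t ]) y ≡ s y
update-below s {suc x} {zero}  t _         = refl
update-below s {suc x} {suc y} t (s≤s y<x) = update-below (s ∘ suc) t y<x

update-above : ∀ s {x y} t → x < y → (s [ x ↦ t ]) y ≡ s y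
update-above s {zero}  {suc y} t _         = refl
update-above s {suc x} {suc y} t (s≤s x<y) = update-above (s ∘ suc) t x<y

-- The last clause lets a subprogram run above the live variables of its caller. Nothing is claimed
-- about the variables above `b`, which are scratch space.
Runs : Command → Variable → Store → ℕ → Tree → Set
Runs C b s τ v = ∃[ s′ ] ⟨ C , s ⟩⇓⟨ τ , s′ ⟩ × s′ b ≡ v × (∀ {y} → y < b → s′ y ≡ s y)

truth⇒≢nil : ∀ {t} → truth t ≡ true → t ≢ nil
truth⇒≢nil () refl

truth⇒≡nil : ∀ {t} → truth t ≡ false → t ≡ nil
truth⇒≡nil {nil} _ = refl

copy-and-run : ∀ {C b c s τ t v} → b < c → s b ≡ t →
  (∀ {s} → s c ≡ t → Runs C c s τ v) → Runs (c ≔ var b ⨾ C) c s (2 + τ) v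
copy-and-run {b = b} {c} {s} b<c refl C-runs
  with s′ , r , e , p ← C-runs {s [ c ↦ s b ]} (update-same s c (s b))
  = s′ , seq assign r , e , λ y<c → trans (p y<c) (update-below s _ y<c)

reverseLoop-runs : ∀ b xs {s r} → s (2 + b) ≡ xs → s (3 + b) ≡ r →
  ∃[ s′ ] ⟨ reverseLoop b , s ⟩⇓⟨ reverseTime xs , s′ ⟩
        × s′ (3 + b) ≡ reverseOnto xs r × (∀ {y} → y < 2 + b → s′ y ≡ s y)
reverseLoop-runs b nil {s} e e′ = s , stop e , e′ , λ _ → refl
reverseLoop-runs b (x ∙ xs) {s} e refl =
  let s₁ = s [ 3 + b ↦ head (s (2 + b)) ∙ s (3 + b) ]
      s₂ = s₁ [ 2 + b ↦ tail (s₁ (2 + b)) ]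
      e₁ : s₁ (2 + b) ≡ x ∙ xs
      e₁ = trans (update-below s _ ≤-refl) e
      e₂ : s₂ (3 + b) ≡ x ∙ s (3 + b)
      e₂ = trans (update-above s₁ _ ≤-refl)
             (trans (update-same s (3 + b) _) (cong (λ t → head t ∙ s (3 + b)) e))
      s′ , r , v , p = reverseLoop-runs b xs {s₂}
        (trans (update-same s₁ (2 + b) _) (cong tail e₁)) e₂
  in s′ , loop (λ z → contradiction (trans (sym e) z) λ ()) (seq assign assign) r , v ,
     λ y< → trans (p y<) (trans (update-below s₁ _ y<) (update-below s _ (m<n⇒m<1+n y<)))

run-runs : ∀ f b {s t} → s b ≡ t → Runs (run f b) b s (time f t) (⟦ f ⟧ t)

foldLoop-runs : ∀ g b xs {s t a} → s b ≡ t → s (1 + b) ≡ a → s (3 + b) ≡ xs →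
  Runs (foldLoop g b) (1 + b) s (foldTime g t a xs)
    (foldLeft (λ acc x → ⟦ g ⟧ (t ∙ acc ∙ x)) a xs)
foldLoop-runs g b nil {s} e₀ e₁ e₃ = s , stop e₃ , e₁ , λ _ → refl
foldLoop-runs g b (x ∙ xs) {s} {t} {a} refl refl e₃ =
  let s₁ = s [ 4 + b ↦ s b ∙ s (1 + b) ∙ head (s (3 + b)) ]
      s₂ , r₂ , v₂ , p₂ = run-runs g (4 + b) {s₁} {s b ∙ s (1 + b) ∙ x}
        (trans (update-same s (4 + b) _) (cong (λ y → s b ∙ s (1 + b) ∙ head y) e₃))
      s₃ = s₂ [ 1 + b ↦ s₂ (4 + b) ]
      s₄ = s₃ [ 3 + b ↦ tail (s₃ (3 + b)) ]
      v₃ : s₃ (3 + b) ≡ x ∙ xs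
      v₃ = trans (update-above s₂ _ (s≤s (s≤s (m≤n+m b 1))))
             (trans (p₂ ≤-refl) (trans (update-below s _ ≤-refl) e₃))
      p₄ : ∀ {y} → y < 1 + b → s₄ y ≡ s y
      p₄ y< = trans (update-below s₃ _ (≤-trans y< (s≤s (m≤n+m b 2))))
                (trans (update-below s₂ _ y<)
                  (trans (p₂ (≤-trans y< (s≤s (m≤n+m b 3))))
                    (update-below s _ (≤-trans y< (s≤s (m≤n+m b 3))))))
      s′ , r , v , p = foldLoop-runs g b xs {s₄} (p₄ ≤-refl)
        (trans (update-below s₃ _ (s≤s (s≤s (m≤n+m b 1)))) (trans (update-same s₂ (1 + b) _) v₂))
        (trans (update-same s₃ (3 + b) _) (cong tail v₃))
  in s′ , loop (λ z → contradiction (trans (sym e₃) z) λ ())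
             (seq assign (seq r₂ (seq assign assign))) r , v ,
     λ y< → trans (p y<) (p₄ y<)

run-runs input b {s} refl =
  _ , assign , update-same s b _ , update-below s _
run-runs leaf b {s} refl =
  _ , assign , update-same s b _ , update-below s _
run-runs (pair f g) b {s} e =
  let s₁ , r₁ , v₁ , p₁ = copy-and-run {s = s} ≤-refl e (run-runs f (1 + b))
      s₂ , r₂ , v₂ , p₂ = copy-and-run {s = s₁} (s≤s (m≤n+m b 1)) (trans (p₁ ≤-refl) e) (run-runs g (2 + b))
  in _ , seq r₁ (seq r₂ assign) ,
     trans (update-same s₂ b _) (cong₂ _∙_ (trans (p₂ ≤-refl) v₁) v₂) ,
     λ y< → trans (update-below s₂ _ y<)
       (trans (p₂ (≤-trans y< (m≤n+m b 2))) (p₁ (m<n⇒m<1+n y<)))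
run-runs (left f) b {s} e =
  let s₁ , r₁ , v₁ , p₁ = run-runs f b {s} e
  in _ , seq r₁ assign , trans (update-same s₁ b _) (cong head v₁) ,
     λ y< → trans (update-below s₁ _ y<) (p₁ y<)
run-runs (right f) b {s} e =
  let s₁ , r₁ , v₁ , p₁ = run-runs f b {s} e
  in _ , seq r₁ assign , trans (update-same s₁ b _) (cong tail v₁) ,
     λ y< → trans (update-below s₁ _ y<) (p₁ y<)
run-runs (branch c f g) b {s} {t} e
  with s₁ , r₁ , v₁ , p₁ ← copy-and-run {s = s} ≤-refl e (run-runs c (1 + b))
  with truth (⟦ c ⟧ t) in eq
... | true =
  let s₂ , r₂ , v₂ , p₂ = run-runs f b {s₁} (trans (p₁ ≤-refl) e)
  in s₂ , seq r₁ (then (λ z → truth⇒≢nil eq (trans (sym v₁) z)) r₂) , v₂ ,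
     λ y< → trans (p₂ y<) (p₁ (m<n⇒m<1+n y<))
... | false =
  let s₂ , r₂ , v₂ , p₂ = run-runs g b {s₁} (trans (p₁ ≤-refl) e)
  in s₂ , seq r₁ (else (trans v₁ (truth⇒≡nil eq)) r₂) , v₂ ,
     λ y< → trans (p₂ y<) (p₁ (m<n⇒m<1+n y<))
run-runs (f after g) b {s} e =
  let s₁ , r₁ , v₁ , p₁ = run-runs g b {s} e
      s₂ , r₂ , v₂ , p₂ = run-runs f b {s₁} v₁
  in s₂ , seq r₁ r₂ , v₂ , λ y< → trans (p₂ y<) (p₁ y<)
run-runs (fold g a l) b {s} {t} e =
  let s₁ , r₁ , v₁ , p₁ = copy-and-run {s = s} ≤-refl e (run-runs a (1 + b))
      s₂ , r₂ , v₂ , p₂ = copy-and-run {s = s₁} (s≤s (m≤n+m b 1)) (trans (p₁ ≤-refl) e) (run-runs l (2 + b))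
      s₃ = s₂ [ 3 + b ↦ nil ]
      s₄ , r₄ , v₄ , p₄ = reverseLoop-runs b (⟦ l ⟧ t) {s₃}
        (trans (update-below s₂ _ ≤-refl) v₂) (update-same s₂ (3 + b) nil)
      below : ∀ {y} → y < 2 + b → s₄ y ≡ s₂ y
      below y< = trans (p₄ y<) (update-below s₂ _ (m<n⇒m<1+n y<))
      p : ∀ {y} → y < 1 + b → s₄ y ≡ s y
      p y< = trans (below (m<n⇒m<1+n y<)) (trans (p₂ (m<n⇒m<1+n y<)) (p₁ y<))
      s₅ , r₅ , v₅ , p₅ = foldLoop-runs g b (reverseOnto (⟦ l ⟧ t) nil) {s₄}
        (trans (p ≤-refl) e) (trans (below ≤-refl) (trans (p₂ ≤-refl) v₁)) v₄
  in _ , seq r₁ (seq r₂ (seq assign (seq r₄ (seq r₅ assign)))) ,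
     trans (update-same s₅ b _) (trans v₅ (foldLeft-reverseOnto _ (⟦ a ⟧ t) (⟦ l ⟧ t) nil)) ,
     λ y< → trans (update-below s₅ _ y<) (trans (p₅ (m<n⇒m<1+n y<)) (p (m<n⇒m<1+n y<)))

-- Time bounds for programs with short folds

spine : Tree → ℕ
spine nil      = 0
spine (_ ∙ xs) = suc (spine xs)

-- Both alternatives of a branch count, so that bounds do not depend on tests.
Small : ℕ → Fn → Tree → Set
SmallSteps : ℕ → Fn → Tree → Tree → Tree → Set

Small N input          t = ⊤
Small N leaf           t = ⊤
Small N (pair f g)     t = Small N f t × Small N g t
Small N (left f)       t = Small N f t
Small N (right f)      t = Small N f t
Small N (branch c f g) t = Small N c t × Small N f t × Small N g t
Small N (f after g)    t = Small N g t × Small N f (⟦ g ⟧ t)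
Small N (fold g a l)   t = Small N a t × Small N l t × spine (⟦ l ⟧ t) ≤ N
                         × SmallSteps N g t (⟦ a ⟧ t) (⟦ l ⟧ t)

SmallSteps N g t a nil      = ⊤
SmallSteps N g t a (x ∙ xs) = SmallSteps N g t a xs
  × Small N g (t ∙ foldTree (λ acc y → ⟦ g ⟧ (t ∙ acc ∙ y)) a xs ∙ x)

-- A crude upper bound for the nesting depth of folds; each level of nesting costs one factor N.
foldCount : Fn → ℕ
foldCount input          = 0
foldCount leaf           = 0
foldCount (pair f g)     = foldCount f + foldCount g
foldCount (left f)       = foldCount f
foldCount (right f)      = foldCount f
foldCount (branch c f g) = foldCount c + (foldCount f + foldCount g)
foldCount (f after g)    = foldCount g + foldCount f
foldCount (fold g a l)   = suc (foldCount g + (foldCount a + foldCount l))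

-- In the case of `fold`, 12 = 10 + 2 covers the reversal, with 10 steps per element and a final
-- test, and 16 = 14 + 2 the main loop, with 14 steps around each call of `g` and a final test.
weight : Fn → ℕ
weight input          = 2
weight leaf           = 2
weight (pair f g)     = (2 + weight f) + ((2 + weight g) + 4)
weight (left f)       = weight f + 3
weight (right f)      = weight f + 3
weight (branch c f g) = (2 + weight c) + (2 + (weight f + weight g))
weight (f after g)    = weight g + weight f
weight (fold g a l)   = (2 + weight a) + ((2 + weight l) + (2 + (12 + ((16 + weight g) + 2))))

module _ {N : ℕ} .{{_ : NonZero N}} where

  private
    -- The power `p` is kept apart from the coefficient `u`: along a sum of running times only the
    -- coefficients add up, exactly as in `weight`.
    record _≼_of_ (x u p : ℕ) : Set where
      constructor within
      field bound : x ≤ u * p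
    open _≼_of_

    infixr 6 _⊕_
    _⊕_ : ∀ {x y u v p} → x ≼ u of p → y ≼ v of p → (x + y) ≼ (u + v) of p
    _⊕_ {u = u} {v} {p} x≤ y≤ =
      within (≤-trans (+-mono-≤ (bound x≤) (bound y≤)) (≤-reflexive (sym (*-distribʳ-+ p u v))))

    const : ∀ e k → k ≼ k of (N ^ e)
    const e k = within (m≤m*n k (N ^ e) {{m^n≢0 N e}})

    iterate : ∀ {e k l u} → l ≤ N → k ≼ u of (N ^ e) → (l * k) ≼ u of (N ^ suc e)
    iterate {e} {k} {l} {u} l≤N k≤ = within (begin
      l * k           ≤⟨ *-mono-≤ l≤N (bound k≤) ⟩
      N * (u * N ^ e) ≡⟨ *-assoc N u (N ^ e) ⟨
      N * u * N ^ e   ≡⟨ cong (_* N ^ e) (*-comm N u) ⟩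
      u * N * N ^ e   ≡⟨ *-assoc u N (N ^ e) ⟩
      u * (N * N ^ e) ∎)
      where open ≤-Reasoning

  reverseTime-spine : ∀ xs → reverseTime xs ≡ 2 + spine xs * 10
  reverseTime-spine nil      = refl
  reverseTime-spine (_ ∙ xs) rewrite reverseTime-spine xs = refl

  LoopSmall : Fn → Tree → Tree → Tree → Set
  LoopSmall g t a nil      = ⊤
  LoopSmall g t a (x ∙ xs) = Small N g (t ∙ a ∙ x) × LoopSmall g t (⟦ g ⟧ (t ∙ a ∙ x)) xs

  -- `SmallSteps` follows the recursion of `foldTree`, whereas the running time follows the loop
  -- over the reversed list. Both make the same calls of `g`, so the bounds carry over.
  loopSmall : ∀ g t a xs r → SmallSteps N g t a xs →
    LoopSmall g t (foldTree (λ acc y → ⟦ g ⟧ (t ∙ acc ∙ y)) a xs) r →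
    LoopSmall g t a (reverseOnto xs r)
  loopSmall g t a nil      r _        q = q
  loopSmall g t a (x ∙ xs) r (p , p′) q = loopSmall g t a xs (x ∙ r) p (p′ , q)

  spine-reverseOnto : ∀ xs r → spine (reverseOnto xs r) ≡ spine xs + spine r
  spine-reverseOnto nil      r = refl
  spine-reverseOnto (x ∙ xs) r = trans (spine-reverseOnto xs (x ∙ r)) (+-suc (spine xs) (spine r))

  -- Any exponent `e` above `foldCount f` is allowed, so that the parts of a program can be compared
  -- with one common power of N. In a fold, one factor of that power pays for the number of
  -- iterations.
  time-bound : ∀ f t {e} → foldCount f ≤ e → Small N f t → time f t ≼ weight f of (N ^ e)

  foldTime-bound : ∀ g t a xs {e} → foldCount g ≤ e → LoopSmall g t a xs →
    foldTime g t a xs ≤ 2 + spine xs * ((14 + weight g) * N ^ e)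
  foldTime-bound g t a nil      _  _       = ≤-refl
  foldTime-bound g t a (x ∙ xs) {e} d≤ (p , q) = begin
    2 + ((7 + (stepTime + 5)) + restTime)  ≡⟨ cong (2 +_) (cong (λ z → (7 + z) + restTime) (+-comm stepTime 5)) ⟩
    (14 + stepTime) + restTime
      ≤⟨ +-mono-≤ (bound (const e 14 ⊕ time-bound g _ d≤ p)) (foldTime-bound g t _ xs d≤ q) ⟩
    W + (2 + spine xs * W)   ≡⟨ +-suc W (suc (spine xs * W)) ⟩
    suc (W + (1 + spine xs * W)) ≡⟨ cong suc (+-suc W (spine xs * W)) ⟩
    2 + (W + spine xs * W)   ∎
    where
    open ≤-Reasoning
    stepTime = time g (t ∙ a ∙ x)
    restTime = foldTime g t (⟦ g ⟧ (t ∙ a ∙ x)) xs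
    W = (14 + weight g) * N ^ e

  time-bound input          t {e} _ _ = const e 2
  time-bound leaf           t {e} _ _ = const e 2
  time-bound (pair f g)     t {e} d (p , q) =
    (const e 2 ⊕ time-bound f t (m+n≤o⇒m≤o _ d) p)
    ⊕ ((const e 2 ⊕ time-bound g t (m+n≤o⇒n≤o (foldCount f) d) q) ⊕ const e 4)
  time-bound (left f)       t {e} d p = time-bound f t d p ⊕ const e 3
  time-bound (right f)      t {e} d p = time-bound f t d p ⊕ const e 3
  time-bound (branch c f g) t {e} d (p , q , r) =
    (const e 2 ⊕ time-bound c t (m+n≤o⇒m≤o _ d) p) ⊕ (const e 2 ⊕ either)
    where
    d′ = m+n≤o⇒n≤o (foldCount c) d
    either : (if truth (⟦ c ⟧ t) then time f t else time g t) ≼ (weight f + weight g) of (N ^ e)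
    either with truth (⟦ c ⟧ t)
    ... | true  = within (≤-trans (bound (time-bound f t (m+n≤o⇒m≤o _ d′) q))
                    (*-monoˡ-≤ (N ^ e) (m≤m+n (weight f) (weight g))))
    ... | false = within (≤-trans (bound (time-bound g t (m+n≤o⇒n≤o (foldCount f) d′) r))
                    (*-monoˡ-≤ (N ^ e) (m≤n+m (weight g) (weight f))))
  time-bound (f after g)    t {e} d (p , q) =
    time-bound g t (m+n≤o⇒m≤o _ d) p ⊕ time-bound f _ (m+n≤o⇒n≤o (foldCount g) d) q
  time-bound (fold g a l)   t {suc e} (s≤s d) (p , q , s , steps) =
    (const (suc e) 2 ⊕ time-bound a t (m≤n⇒m≤1+n (m+n≤o⇒m≤o _ d′)) p)
    ⊕ ((const (suc e) 2 ⊕ time-bound l t (m≤n⇒m≤1+n (m+n≤o⇒n≤o (foldCount a) d′)) q)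
    ⊕ (const (suc e) 2 ⊕ (reversal ⊕ (iteration ⊕ const (suc e) 2))))
    where
    d′ = m+n≤o⇒n≤o (foldCount g) d
    reversal : reverseTime (⟦ l ⟧ t) ≼ 12 of (N ^ suc e)
    reversal rewrite reverseTime-spine (⟦ l ⟧ t) =
      const (suc e) 2 ⊕ iterate {e} s (const e 10)
    iteration : foldTime g t (⟦ a ⟧ t) (reverseOnto (⟦ l ⟧ t) nil)
              ≼ (16 + weight g) of (N ^ suc e)
    iteration = within (≤-trans
      (foldTime-bound g t _ _ (m+n≤o⇒m≤o _ d) (loopSmall g t _ (⟦ l ⟧ t) nil steps tt))
      (bound (const (suc e) 2 ⊕ iterate {e} {u = 14 + weight g}
        (subst (_≤ N) (sym (trans (spine-reverseOnto (⟦ l ⟧ t) nil) (+-identityʳ _))) s)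
        (within ≤-refl))))

  time≤weight*N^foldCount : ∀ f t → Small N f t → time f t ≤ weight f * N ^ foldCount f
  time≤weight*N^foldCount f t p = bound (time-bound f t ≤-refl p)

computes : ∀ f t → Computes run f 0 on t inTime time f t output ⟦ f ⟧ t
computes f t with s , r , e , _ ← run-runs f 0 (update-same (λ _ → nil) 0 t) = s , r , e

context accumulator element : Fn
context     = left input
accumulator = left (right input)
element     = right (right input)

-- Unary arithmetic

numeral : ℕ → Fn
numeral zero    = leaf
numeral (suc m) = pair leaf (numeral m)

-- These serve to show that the time factor is a computable function of d. Within a step the operand
-- has to be evaluated on the outer input, hence `after context`.
_+ᶠ_ _*ᶠ_ _^ᶠ_ : Fn → Fn → Fn
f +ᶠ g = fold (pair leaf accumulator) g f
f *ᶠ g = fold ((g after context) +ᶠ accumulator) leaf f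
f ^ᶠ g = fold ((f after context) *ᶠ accumulator) (numeral 1) g

numeral-correct : ∀ m t → ⟦ numeral m ⟧ t ≡ encodeℕ m
numeral-correct zero    t = refl
numeral-correct (suc m) t = cong (nil ∙_) (numeral-correct m t)

module _ {f g t m n} (f≡ : ⟦ f ⟧ t ≡ encodeℕ m) (g≡ : ⟦ g ⟧ t ≡ encodeℕ n) where

  +ᶠ-correct : ⟦ f +ᶠ g ⟧ t ≡ encodeℕ (m + n)
  +ᶠ-correct rewrite f≡ | g≡ = go m
    where
    go : ∀ m → foldTree (λ acc x → nil ∙ acc) (encodeℕ n) (encodeℕ m) ≡ encodeℕ (m + n)
    go zero    = refl
    go (suc m) = cong (nil ∙_) (go m)

*ᶠ-correct : ∀ {f g t m n} → ⟦ f ⟧ t ≡ encodeℕ m → ⟦ g ⟧ t ≡ encodeℕ n →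
  ⟦ f *ᶠ g ⟧ t ≡ encodeℕ (m * n)
*ᶠ-correct {f} {g} {t} {m} {n} f≡ g≡ rewrite f≡ = go m
  where
  go : ∀ m → foldTree (λ acc x → ⟦ (g after context) +ᶠ accumulator ⟧ (t ∙ acc ∙ x)) nil (encodeℕ m)
           ≡ encodeℕ (m * n)
  go zero    = refl
  go (suc m) = +ᶠ-correct {f = g after context} {g = accumulator} {t = t ∙ _ ∙ nil} g≡ (go m)

^ᶠ-correct : ∀ {f g t m n} → ⟦ f ⟧ t ≡ encodeℕ m → ⟦ g ⟧ t ≡ encodeℕ n →
  ⟦ f ^ᶠ g ⟧ t ≡ encodeℕ (m ^ n)
^ᶠ-correct {f} {g} {t} {m} {n} f≡ g≡ rewrite g≡ = go n
  where
  go : ∀ n → foldTree (λ acc x → ⟦ (f after context) *ᶠ accumulator ⟧ (t ∙ acc ∙ x)) (nil ∙ nil) (encodeℕ n)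
           ≡ encodeℕ (m ^ n)
  go zero    = refl
  go (suc n) = *ᶠ-correct {f = f after context} {g = accumulator} {t = t ∙ _ ∙ nil} f≡ (go n)

-- Evaluation with bounded folds

-- Value and bound are established together, since the length of an inner fold is known only through
-- the value of the list it runs over.
record Evaluates (N : ℕ) (f : Fn) (t v : Tree) : Set where
  constructor _,_
  field
    value : ⟦ f ⟧ t ≡ v
    small : Small N f t

truth-encodeBool : ∀ b → truth (encodeBool b) ≡ b
truth-encodeBool true  = refl
truth-encodeBool false = refl

spine-encodeList : ∀ ts → spine (encodeList ts) ≡ length ts
spine-encodeList []       = refl
spine-encodeList (t ∷ ts) = cong suc (spine-encodeList ts)

truth-drop : ∀ m ts → truth (encodeList (drop m ts)) ≡ (m <ᵇ length ts)
truth-drop zero    []       = refl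
truth-drop zero    (_ ∷ _)  = refl
truth-drop (suc m) []       = refl
truth-drop (suc m) (_ ∷ ts) = truth-drop m ts

tail-drop : ∀ m ts → tail (encodeList (drop m ts)) ≡ encodeList (drop (suc m) ts)
tail-drop zero    []       = refl
tail-drop zero    (_ ∷ _)  = refl
tail-drop (suc m) []       = refl
tail-drop (suc m) (_ ∷ ts) = tail-drop m ts

tails : ℕ → Tree → Tree
tails zero    t = t
tails (suc m) t = tail (tails m t)

tails-encodeList : ∀ m ts → tails m (encodeList ts) ≡ encodeList (drop m ts)
tails-encodeList zero    ts = refl
tails-encodeList (suc m) ts = trans (cong tail (tails-encodeList m ts)) (tail-drop m ts)

tails-nil : ∀ m → tails m nil ≡ nil
tails-nil zero    = refl
tails-nil (suc m) = cong tail (tails-nil m)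

spine-tail : ∀ t → spine (tail t) ≡ spine t ∸ 1
spine-tail nil     = refl
spine-tail (_ ∙ _) = refl

spine-tails : ∀ m t → spine (tails m t) ≡ spine t ∸ m
spine-tails zero    t = refl
spine-tails (suc m) t = begin
  spine (tail (tails m t)) ≡⟨ spine-tail (tails m t) ⟩
  spine (tails m t) ∸ 1    ≡⟨ cong (_∸ 1) (spine-tails m t) ⟩
  spine t ∸ m ∸ 1          ≡⟨ ∸-+-assoc (spine t) m 1 ⟩
  spine t ∸ (m + 1)        ≡⟨ cong (spine t ∸_) (+-comm m 1) ⟩
  spine t ∸ suc m          ∎
  where open ≡-Reasoning

truth-spine : ∀ t → truth t ≡ (0 <ᵇ spine t)
truth-spine nil     = refl
truth-spine (_ ∙ _) = refl

0<ᵇ-∸ : ∀ m n → (0 <ᵇ m ∸ n) ≡ (n <ᵇ m)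
0<ᵇ-∸ zero    zero    = refl
0<ᵇ-∸ zero    (suc n) = refl
0<ᵇ-∸ (suc m) zero    = refl
0<ᵇ-∸ (suc m) (suc n) = 0<ᵇ-∸ m n

truth-tails : ∀ m t → truth (tails m t) ≡ (m <ᵇ spine t)
truth-tails m t = trans (truth-spine (tails m t))
  (trans (cong (0 <ᵇ_) (spine-tails m t)) (0<ᵇ-∸ (spine t) m))

bit : Bool → ℕ
bit b = if b then 1 else 0

count : ∀ {A : Set} → (A → Bool) → List A → ℕ
count p []       = 0
count p (x ∷ xs) = bit (p x) + count p xs

module _ {N : ℕ} where

  pairᵉ : ∀ {f g t v w} → Evaluates N f t v → Evaluates N g t w → Evaluates N (pair f g) t (v ∙ w)
  pairᵉ (refl , p) (refl , q) = refl , p , q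

  leftᵉ : ∀ {f t v} → Evaluates N f t v → Evaluates N (left f) t (head v)
  leftᵉ (refl , p) = refl , p

  rightᵉ : ∀ {f t v} → Evaluates N f t v → Evaluates N (right f) t (tail v)
  rightᵉ (refl , p) = refl , p

  afterᵉ : ∀ {f g t v w} → Evaluates N g t v → Evaluates N f v w → Evaluates N (f after g) t w
  afterᵉ (refl , p) (refl , q) = refl , p , q

  branchᵉ : ∀ {c f g t b u v w} → Evaluates N c t u → truth u ≡ b →
    Evaluates N f t v → Evaluates N g t w → Evaluates N (branch c f g) t (if b then v else w)
  branchᵉ (refl , p) refl (refl , q) (refl , r) = refl , p , q , r

  recast : ∀ {f t v w} → v ≡ w → Evaluates N f t v → Evaluates N f t w
  recast refl e = e

  -- Reduces a fold to one step of the recursion that defines `φ`. The invariant `P` of suffixes is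
  -- for steps whose value or size depends on what follows in the list.
  foldᵉ : ∀ {A : Set} (enc : A → Tree) (φ : List A → Tree) (P : List A → Set) →
    (∀ {x ys} → P (x ∷ ys) → P ys) →
    ∀ {g a l t xs} → P xs → length xs ≤ N →
    Evaluates N a t (φ []) → Evaluates N l t (encodeList (map enc xs)) →
    (∀ x ys → P (x ∷ ys) → Evaluates N g (t ∙ φ ys ∙ enc x) (φ (x ∷ ys))) →
    Evaluates N (fold g a l) t (φ xs)
  foldᵉ enc φ P rest {g} {a} {l} {t} {xs} px len (a≡ , sa) (l≡ , sl) step =
    trans (cong₂ (foldTree h) a≡ l≡) (proj₁ (go xs px)) , (sa , sl ,
    subst (_≤ N) (sym (trans (cong spine l≡) (trans (spine-encodeList (map enc xs)) (length-map enc xs)))) len ,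
    subst₂ (SmallSteps N g t) (sym a≡) (sym l≡) (proj₂ (go xs px)))
    where
    h : Tree → Tree → Tree
    h acc x = ⟦ g ⟧ (t ∙ acc ∙ x)
    go : ∀ ys → P ys → foldTree h (φ []) (encodeList (map enc ys)) ≡ φ ys
                     × SmallSteps N g t (φ []) (encodeList (map enc ys))
    go []       p = refl , tt
    go (y ∷ ys) p with e , s ← go ys (rest p) | e′ , s′ ← step y ys p =
      trans (cong (λ acc → h acc (enc y)) e) e′ ,
      s , subst (λ acc → Small N g (t ∙ acc ∙ enc y)) (sym e) s′

  foldᵉ′ : ∀ {A : Set} (enc : A → Tree) (φ : List A → Tree) →
    ∀ {g a l t xs} → length xs ≤ N →
    Evaluates N a t (φ []) → Evaluates N l t (encodeList (map enc xs)) →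
    (∀ x ys → Evaluates N g (t ∙ φ ys ∙ enc x) (φ (x ∷ ys))) →
    Evaluates N (fold g a l) t (φ xs)
  foldᵉ′ enc φ len a l step = foldᵉ enc φ (λ _ → ⊤) (λ _ → tt) tt len a l (λ x ys _ → step x ys)

-- The sole access to positions: the head of the result is a table lookup, and its being nonempty is
-- the comparison `spine i < spine r`. The fold runs over the index `i`, whatever the length of `r`.
dropF : Fn
dropF = fold (right accumulator) (right input) (left input)

dropᵉ : ∀ {N} i r → spine i ≤ N → Evaluates N dropF (i ∙ r) (tails (spine i) r)
dropᵉ {N} i r i≤N = go i , _ , _ , i≤N , steps i
  where
  go : ∀ j → foldTree (λ acc x → tail acc) r j ≡ tails (spine j) r
  go nil      = refl
  go (_ ∙ js) = cong tail (go js)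
  steps : ∀ j → SmallSteps N (right accumulator) (i ∙ r) r j
  steps nil      = tt
  steps (_ ∙ js) = steps js , _

-- The algorithm

-- A vertex is represented by its index i (a tree with a spine of length i),
-- whether it is big, and its row of the adjacency matrix.

-- Starts from the row itself, of length n, and removes two of its cells for every neighbour.
-- Something is left exactly if twice the degree is less than n.
truncatedDegree : Fn
truncatedDegree = fold (branch element (right (right accumulator)) accumulator) input input

-- A right fold knows how many vertices come later, not how many came before. The index of a vertex
-- is therefore what remains of the list of rows when one row is dropped for each later vertex and
-- one for the vertex itself; only its spine matters.
makeVertices : Fn
makeVertices = fold
  (pair (pair (right (dropF after pair accumulator (left context)))
              (pair (branch (truncatedDegree after element) leaf (numeral 1)) element))
        accumulator)
  leaf (left input)

edge : Fn
edge = left (dropF after pair (left (right input)) (right (right (left input))))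

coreEdge : Fn
coreEdge = branch (left (right (left input))) edge (branch (left (right (right input))) edge leaf)

threshold : Fn
threshold = fold
  (branch (left (right element)) (pair leaf (pair leaf (pair leaf accumulator))) accumulator)
  (numeral 1) input

areTwins : Fn
areTwins = fold
  (branch (coreEdge after pair (left (right context)) element)
    (branch (coreEdge after pair (right (right context)) element) accumulator leaf)
    (branch (coreEdge after pair (right (right context)) element) leaf accumulator))
  (numeral 1) (left input)

hasRoom : Fn
hasRoom = fold
  (branch (areTwins after pair (left context) (pair (right (right (right context))) element))
    (right accumulator) accumulator)
  (left (right input)) (left (right (right input)))

makeKernel : Fn
makeKernel = fold
  (branch (hasRoom after pair (left context) (pair (right context) (pair accumulator element)))
    (pair element accumulator) accumulator)
  leaf (left input)

sameVertex : Fn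
sameVertex =
  branch (dropF after pair (left (left input)) (left (right input))) leaf
    (branch (dropF after pair (left (right input)) (left (left input))) leaf (numeral 1))

isFresh : Fn
isFresh = fold (branch (sameVertex after pair (left context) element) leaf accumulator)
  (numeral 1) (right input)

extendWord : Fn
extendWord = fold
  (branch (isFresh after pair element (right (right context)))
    (pair (pair element (right (right context))) accumulator) accumulator)
  (left (right input)) (left input)

extendWords : Fn
extendWords = fold (extendWord after pair (left context) (pair accumulator element)) leaf (right input)

-- The kernel plays two roles: as `context` it is the alphabet, and as the list folded over it
-- counts the letters. `numeral 1` doubles as the list whose only member is the empty word.
makeWords : Fn
makeWords = fold (extendWords after pair context accumulator) (numeral 1) input

-- The accumulator pairs the rest of the budget with the vertex met last, which is the successor in
-- the word. The fold runs over the word, and the budget k is only shortened, so its length does not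
-- affect the time.
budgetAfter : Fn
budgetAfter = left (fold
  (pair (branch (coreEdge after pair (right accumulator) element)
          (right (left accumulator)) (left accumulator))
        element)
  (pair (left input) leaf) (right input))

search : Fn
search = fold (branch (budgetAfter after pair (right context) element) (numeral 1) accumulator)
  leaf (left input)

antiPathCover : Fn
antiPathCover = search after pair
  (makeWords after makeKernel after pair input threshold after makeVertices) (right input)

-- Breaks, and the words without repetition over an alphabet

breaks : ∀ {A : Set} → (A → A → Bool) → List A → ℕ
breaks p []          = 0
breaks p (x ∷ [])    = 0
breaks p (x ∷ y ∷ w) = bit (p x y) + breaks p (y ∷ w)

sameIndex : ∀ {n} → Fin n → Fin n → Bool
sameIndex x y = not (toℕ x <ᵇ toℕ y) ∧ not (toℕ y <ᵇ toℕ x)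

fresh : ∀ {n} → Fin n → List (Fin n) → Bool
fresh x = all (not ∘ sameIndex x)

extensions : ∀ {n} → List (Fin n) → List (List (Fin n)) → List (Fin n) → List (List (Fin n))
extensions xs out w = foldr (λ x ws → if fresh x w then (x ∷ w) ∷ ws else ws) out xs

wordsOver : ∀ {n} → List (Fin n) → ℕ → List (List (Fin n))
wordsOver xs zero    = [] ∷ []
wordsOver xs (suc j) = foldr (λ w ws → extensions xs ws w) [] (wordsOver xs j)

length-extensions : ∀ {n} (xs : List (Fin n)) out w →
  length (extensions xs out w) ≤ length xs + length out
length-extensions []       out w = ≤-refl
length-extensions (x ∷ xs) out w with fresh x w
... | true  = s≤s (length-extensions xs out w)
... | false = m≤n⇒m≤1+n (length-extensions xs out w)

length-wordsOver : ∀ {n} (xs : List (Fin n)) j → length (wordsOver xs j) ≤ length xs ^ j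
length-wordsOver xs zero    = ≤-refl
length-wordsOver {n} xs (suc j) = ≤-trans (go (wordsOver xs j))
  (≤-trans (*-monoˡ-≤ (length xs) (length-wordsOver xs j)) (≤-reflexive (*-comm _ (length xs))))
  where
  go : ∀ ws → length (foldr (λ w vs → extensions xs vs w) [] ws) ≤ length ws * length xs
  go []       = z≤n
  go (w ∷ ws) = ≤-trans (length-extensions xs _ w) (+-monoʳ-≤ (length xs) (go ws))

module _ {n} {P : List (Fin n) → Set} where

  All-extensions : ∀ xs {out w} → (∀ x → P (x ∷ w)) → All P out → All P (extensions xs out w)
  All-extensions []       f ps = ps
  All-extensions (x ∷ xs) {w = w} f ps with fresh x w
  ... | true  = f x ∷ All-extensions xs f ps
  ... | false = All-extensions xs f ps

wordsOver-length : ∀ {n} (xs : List (Fin n)) j → All (λ w → length w ≡ j) (wordsOver xs j)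
wordsOver-length xs zero    = refl ∷ []
wordsOver-length {n} xs (suc j) = go (wordsOver-length xs j)
  where
  go : ∀ {ws} → All (λ w → length w ≡ j) ws →
    All (λ w → length w ≡ suc j) (foldr (λ w vs → extensions xs vs w) [] ws)
  go []       = []
  go (p ∷ ps) = All-extensions xs (λ x → cong suc p) (go ps)

head-drop-tabulate : ∀ {n} (f : Fin n → Tree) i → head (encodeList (drop (toℕ i) (tabulate f))) ≡ f i
head-drop-tabulate f zero    = refl
head-drop-tabulate f (suc i) = head-drop-tabulate (f ∘ suc) i

-- The kernel of a graph, and what each program computes

module Core {n} (G : Graph n) where

  open Graph G

  degree : Fin n → ℕ
  degree v = count (adj v) (allFin n)

  -- big is the set H of the introduction, and core the adjacency of G′.
  big : Fin n → Bool
  big v = not (2 * degree v <ᵇ n)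

  core : Fin n → Fin n → Bool
  core u v = (big u ∨ big v) ∧ adj u v

  core-symmetric : ∀ u v → core u v ≡ core v u
  core-symmetric u v = cong₂ _∧_ (∨-comm (big u) (big v)) (symmetric u v)

  twins : Fin n → Fin n → Bool
  twins u v = all (λ x → not (core u x xor core v x)) (allFin n)

  kernel : ℕ → List (Fin n) → List (Fin n)
  kernel m []       = []
  kernel m (v ∷ vs) = if count (twins v) (kernel m vs) <ᵇ m then v ∷ kernel m vs else kernel m vs

  kernel-length : ∀ m vs → length (kernel m vs) ≤ length vs
  kernel-length m []       = z≤n
  kernel-length m (v ∷ vs) with count (twins v) (kernel m vs) <ᵇ m
  ... | true  = s≤s (kernel-length m vs)
  ... | false = m≤n⇒m≤1+n (kernel-length m vs)

  bigCount capacity : ℕ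
  bigCount = count big (allFin n)
  capacity = suc (bigCount * 3)

  kernelVertices : List (Fin n)
  kernelVertices = kernel capacity (allFin n)

  accepts : ℕ → Bool
  accepts k = any (λ w → breaks core w <ᵇ k) (wordsOver kernelVertices (length kernelVertices))

  rowTree index encodeVertex : Fin n → Tree
  rowTree u      = encodeList (map (λ v → encodeBool (adj u v)) (allFin n))
  index u        = tails (n ∸ toℕ u) (encodeGraph G)
  encodeVertex u = index u ∙ encodeBool (big u) ∙ rowTree u

  encodeVertices : List (Fin n) → Tree
  encodeVertices vs = encodeList (map encodeVertex vs)

  encodeWords : List (List (Fin n)) → Tree
  encodeWords ws = encodeList (map encodeVertices ws)

  length-allFin : length (allFin n) ≡ n
  length-allFin = length-tabulate id

  spine-encode : ∀ {A : Set} (enc : A → Tree) xs → spine (encodeList (map enc xs)) ≡ length xs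
  spine-encode enc xs = trans (spine-encodeList (map enc xs)) (length-map enc xs)

  spine-index : ∀ u → spine (index u) ≡ toℕ u
  spine-index u = begin
    spine (index u)                      ≡⟨ spine-tails (n ∸ toℕ u) (encodeGraph G) ⟩
    spine (encodeGraph G) ∸ (n ∸ toℕ u)  ≡⟨ cong (_∸ (n ∸ toℕ u)) (trans (spine-encode rowTree (allFin n)) length-allFin) ⟩
    n ∸ (n ∸ toℕ u)                      ≡⟨ m∸[m∸n]≡n (<⇒≤ (toℕ<n u)) ⟩
    toℕ u                                ∎
    where open ≡-Reasoning

  -- Suffixes of allFin n, in which an element determines the length of the rest.
  Counting : List (Fin n) → Set
  Counting []       = ⊤
  Counting (x ∷ xs) = toℕ x + suc (length xs) ≡ n × Counting xs

  counting : Counting (allFin n)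
  counting = go id (λ i → refl)
    where
    go : ∀ {m} (f : Fin m → Fin n) → (∀ i → toℕ (f i) + m ≡ toℕ i + n) → Counting (tabulate f)
    go {zero}  f eq = tt
    go {suc m} f eq =
      subst (λ l → toℕ (f zero) + suc l ≡ n) (sym (length-tabulate (f ∘ suc))) (eq zero) ,
      go (f ∘ suc) (λ i → suc-injective (trans (sym (+-suc (toℕ (f (suc i))) m)) (eq (suc i))))

  module _ {N : ℕ} (n≤N : n ≤ N) where

    allFin≤N : length (allFin n) ≤ N
    allFin≤N = ≤-trans (≤-reflexive length-allFin) n≤N

    truncatedDegreeᵉ : ∀ u → Evaluates N truncatedDegree (rowTree u)
      (encodeList (drop (2 * degree u) (map (λ v → encodeBool (adj u v)) (allFin n))))
    truncatedDegreeᵉ u = foldᵉ′ (λ v → encodeBool (adj u v))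
      (λ ys → encodeList (drop (2 * count (adj u) ys) cells)) allFin≤N (refl , _) (refl , _)
      λ x ys → recast (step (adj u x) (count (adj u) ys))
        (branchᵉ (refl , _) (truth-encodeBool (adj u x)) (refl , _) (refl , _))
      where
      cells = map (λ v → encodeBool (adj u v)) (allFin n)
      step : ∀ b c → (if b then tail (tail (encodeList (drop (2 * c) cells))) else encodeList (drop (2 * c) cells))
                   ≡ encodeList (drop (2 * (bit b + c)) cells)
      step true  c rewrite *-suc 2 c =
        trans (cong tail (tail-drop (2 * c) cells)) (tail-drop (suc (2 * c)) cells)
      step false c = refl

    bigᵉ : ∀ u → Evaluates N (branch truncatedDegree leaf (numeral 1)) (rowTree u) (encodeBool (big u))
    bigᵉ u = recast (eq (2 * degree u <ᵇ n))
      (branchᵉ (truncatedDegreeᵉ u)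
        (trans (truth-drop (2 * degree u) _)
          (cong (2 * degree u <ᵇ_) (trans (length-map _ (allFin n)) length-allFin)))
        (refl , _) (refl , _))
      where
      eq : ∀ b → (if b then nil else (nil ∙ nil)) ≡ encodeBool (not b)
      eq true  = refl
      eq false = refl

    makeVerticesᵉ : ∀ k → Evaluates N makeVertices (encodeGraph G ∙ k) (encodeVertices (allFin n))
    makeVerticesᵉ k = foldᵉ rowTree encodeVertices Counting proj₂ counting allFin≤N
      (refl , _) (refl , _)
      λ x ys p → pairᵉ
        (pairᵉ
          (recast (cong (λ j → tails j (encodeGraph G)) (indexEq x ys p))
            (rightᵉ (afterᵉ (refl , _) (dropᵉ (encodeVertices ys) (encodeGraph G)
              (≤-trans (≤-reflexive (spine-encode encodeVertex ys)) (short x ys p))))))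
          (pairᵉ (flag x ys) (refl , _)))
        (refl , _)
      where
      indexEq : ∀ x ys → Counting (x ∷ ys) → suc (spine (encodeVertices ys)) ≡ n ∸ toℕ x
      indexEq x ys (e , _) = trans (cong suc (spine-encode encodeVertex ys))
        (trans (sym (m+n∸m≡n (toℕ x) (suc (length ys)))) (cong (_∸ toℕ x) e))
      short : ∀ x ys → Counting (x ∷ ys) → length ys ≤ N
      short x ys (e , _) = ≤-trans (n≤1+n _) (≤-trans (m≤n+m _ (toℕ x)) (≤-trans (≤-reflexive e) n≤N))
      flag : ∀ x ys → Evaluates N (branch (truncatedDegree after element) leaf (numeral 1))
        ((encodeGraph G ∙ k) ∙ encodeVertices ys ∙ rowTree x) (encodeBool (big x))
      flag x ys with v , (s , _) ← bigᵉ x = v , ((_ , s) , _)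

    edgeᵉ : ∀ u v → Evaluates N edge (encodeVertex u ∙ encodeVertex v) (encodeBool (adj u v))
    edgeᵉ u v = recast lookup
      (leftᵉ (afterᵉ (refl , _) (dropᵉ (index v) (rowTree u)
        (≤-trans (≤-reflexive (spine-index v)) (≤-trans (<⇒≤ (toℕ<n v)) n≤N)))))
      where
      open ≡-Reasoning
      entry : Fin n → Tree
      entry w = encodeBool (adj u w)
      lookup : head (tails (spine (index v)) (rowTree u)) ≡ entry v
      lookup = begin
        head (tails (spine (index v)) (rowTree u))
          ≡⟨ cong (λ j → head (tails j (rowTree u))) (spine-index v) ⟩
        head (tails (toℕ v) (rowTree u))
          ≡⟨ cong head (tails-encodeList (toℕ v) (map entry (allFin n))) ⟩
        head (encodeList (drop (toℕ v) (map entry (allFin n))))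
          ≡⟨ cong (λ ts → head (encodeList (drop (toℕ v) ts))) (map-tabulate id entry) ⟩
        head (encodeList (drop (toℕ v) (tabulate entry)))
          ≡⟨ head-drop-tabulate entry v ⟩
        entry v ∎

    coreEdgeᵉ : ∀ u v → Evaluates N coreEdge (encodeVertex u ∙ encodeVertex v) (encodeBool (core u v))
    coreEdgeᵉ u v = recast (eq (big u) (big v) (adj u v))
      (branchᵉ (refl , _) (truth-encodeBool (big u)) (edgeᵉ u v)
        (branchᵉ (refl , _) (truth-encodeBool (big v)) (edgeᵉ u v) (refl , _)))
      where
      eq : ∀ a b c → (if a then encodeBool c else (if b then encodeBool c else nil))
                   ≡ encodeBool ((a ∨ b) ∧ c)
      eq true  b     c = refl
      eq false true  c = refl
      eq false false c = refl

    -- In `budgetAfter`, `nil` stands for the missing successor of the last vertex of a word; it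
    -- must not count as a break.
    noEdgeᵉ : ∀ v → Evaluates N coreEdge (nil ∙ encodeVertex v) nil
    noEdgeᵉ v = recast (eq (big v))
      (branchᵉ (refl , _) refl none (branchᵉ (refl , _) (truth-encodeBool (big v)) none (refl , _)))
      where
      none : Evaluates N edge (nil ∙ encodeVertex v) nil
      none = recast (cong head (tails-nil (spine (index v))))
        (leftᵉ (afterᵉ (refl , _) (dropᵉ (index v) nil
          (≤-trans (≤-reflexive (spine-index v)) (≤-trans (<⇒≤ (toℕ<n v)) n≤N)))))
      eq : ∀ b → (if b then nil else nil) ≡ nil
      eq true  = refl
      eq false = refl

    thresholdᵉ : Evaluates N threshold (encodeVertices (allFin n)) (encodeℕ capacity)
    thresholdᵉ = foldᵉ′ encodeVertex (λ ys → encodeℕ (suc (count big ys * 3))) allFin≤N (refl , _) (refl , _)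
      λ x ys → recast (eq (big x) (count big ys))
        (branchᵉ (refl , _) (truth-encodeBool (big x)) (refl , _) (refl , _))
      where
      eq : ∀ b c → (if b then nil ∙ nil ∙ nil ∙ encodeℕ (suc (c * 3)) else encodeℕ (suc (c * 3)))
                 ≡ encodeℕ (suc ((bit b + c) * 3))
      eq true  c = refl
      eq false c = refl

    areTwinsᵉ : ∀ u v → Evaluates N areTwins
      (encodeVertices (allFin n) ∙ encodeVertex u ∙ encodeVertex v) (encodeBool (twins u v))
    areTwinsᵉ u v = foldᵉ′ encodeVertex
      (λ ys → encodeBool (all (λ x → not (core u x xor core v x)) ys)) allFin≤N (refl , _) (refl , _)
      λ x ys → recast (eq (core u x) (core v x) (all (λ x → not (core u x xor core v x)) ys))
        (branchᵉ (afterᵉ (refl , _) (coreEdgeᵉ u x)) (truth-encodeBool (core u x))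
          (branchᵉ (afterᵉ (refl , _) (coreEdgeᵉ v x)) (truth-encodeBool (core v x)) (refl , _) (refl , _))
          (branchᵉ (afterᵉ (refl , _) (coreEdgeᵉ v x)) (truth-encodeBool (core v x)) (refl , _) (refl , _)))
      where
      eq : ∀ a b c → (if a then (if b then encodeBool c else nil) else (if b then nil else encodeBool c))
                   ≡ encodeBool (not (a xor b) ∧ c)
      eq true  true  c = refl
      eq true  false c = refl
      eq false true  c = refl
      eq false false c = refl

    hasRoomᵉ : ∀ m K v → length K ≤ N → Evaluates N hasRoom
      (encodeVertices (allFin n) ∙ encodeℕ m ∙ encodeVertices K ∙ encodeVertex v)
      (encodeList (drop (count (twins v) K) (replicate m nil)))
    hasRoomᵉ m K v K≤N = foldᵉ′ encodeVertex
      (λ ys → encodeList (drop (count (twins v) ys) (replicate m nil))) K≤N (refl , _) (refl , _)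
      λ x ys → recast (eq (twins v x) (count (twins v) ys))
        (branchᵉ (afterᵉ (refl , _) (areTwinsᵉ v x)) (truth-encodeBool (twins v x)) (refl , _) (refl , _))
      where
      ts = replicate m nil
      eq : ∀ b c → (if b then tail (encodeList (drop c ts)) else encodeList (drop c ts))
                 ≡ encodeList (drop (bit b + c) ts)
      eq true  c = tail-drop c ts
      eq false c = refl

    makeKernelᵉ : ∀ m → Evaluates N makeKernel (encodeVertices (allFin n) ∙ encodeℕ m)
      (encodeVertices (kernel m (allFin n)))
    makeKernelᵉ m = foldᵉ encodeVertex (encodeVertices ∘ kernel m) (λ ys → length ys ≤ N)
      (≤-trans (n≤1+n _)) allFin≤N allFin≤N (refl , _) (refl , _)
      λ x ys p → recast (eq (count (twins x) (kernel m ys) <ᵇ m) x (kernel m ys))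
        (branchᵉ (afterᵉ (refl , _) (hasRoomᵉ m (kernel m ys) x
            (≤-trans (kernel-length m ys) (≤-trans (n≤1+n _) p))))
          (trans (truth-drop (count (twins x) (kernel m ys)) (replicate m nil))
            (cong (count (twins x) (kernel m ys) <ᵇ_) (length-replicate m)))
          (refl , _) (refl , _))
      where
      eq : ∀ b x K → (if b then encodeVertex x ∙ encodeVertices K else encodeVertices K)
                   ≡ encodeVertices (if b then x ∷ K else K)
      eq true  x K = refl
      eq false x K = refl

    sameVertexᵉ : ∀ x y → Evaluates N sameVertex (encodeVertex x ∙ encodeVertex y) (encodeBool (sameIndex x y))
    sameVertexᵉ x y = recast (eq (toℕ x <ᵇ toℕ y) (toℕ y <ᵇ toℕ x))
      (branchᵉ (dropIndex x y (refl , _) (refl , _)) (below x y) (refl , _)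
        (branchᵉ (dropIndex y x (refl , _) (refl , _)) (below y x) (refl , _) (refl , _)))
      where
      dropIndex : ∀ x y {f g t} → Evaluates N f t (index x) → Evaluates N g t (index y) →
        Evaluates N (dropF after pair f g) t (tails (spine (index x)) (index y))
      dropIndex x y e e′ = afterᵉ (pairᵉ e e′) (dropᵉ (index x) (index y)
        (≤-trans (≤-reflexive (spine-index x)) (≤-trans (<⇒≤ (toℕ<n x)) n≤N)))
      below : ∀ x y → truth (tails (spine (index x)) (index y)) ≡ (toℕ x <ᵇ toℕ y)
      below x y = trans (truth-tails (spine (index x)) (index y)) (cong₂ _<ᵇ_ (spine-index x) (spine-index y))
      eq : ∀ a b → (if a then nil else (if b then nil else (nil ∙ nil))) ≡ encodeBool (not a ∧ not b)
      eq true  b     = refl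
      eq false true  = refl
      eq false false = refl

    isFreshᵉ : ∀ x w → length w ≤ N →
      Evaluates N isFresh (encodeVertex x ∙ encodeVertices w) (encodeBool (fresh x w))
    isFreshᵉ x w w≤N = foldᵉ′ encodeVertex (λ ys → encodeBool (fresh x ys)) w≤N (refl , _) (refl , _)
      λ y ys → recast (eq (sameIndex x y) (fresh x ys))
        (branchᵉ (afterᵉ (refl , _) (sameVertexᵉ x y)) (truth-encodeBool (sameIndex x y)) (refl , _) (refl , _))
      where
      eq : ∀ a b → (if a then nil else encodeBool b) ≡ encodeBool (not a ∧ b)
      eq true  b = refl
      eq false b = refl

    extendWordᵉ : ∀ K out w → length K ≤ N → length w ≤ N → Evaluates N extendWord
      (encodeVertices K ∙ encodeWords out ∙ encodeVertices w) (encodeWords (extensions K out w))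
    extendWordᵉ K out w K≤N w≤N = foldᵉ′ encodeVertex (λ ys → encodeWords (extensions ys out w)) K≤N
      (refl , _) (refl , _)
      λ x ys → recast (eq (fresh x w) x (extensions ys out w))
        (branchᵉ (afterᵉ (refl , _) (isFreshᵉ x w w≤N)) (truth-encodeBool (fresh x w)) (refl , _) (refl , _))
      where
      eq : ∀ b x ws → (if b then encodeVertices (x ∷ w) ∙ encodeWords ws else encodeWords ws)
                    ≡ encodeWords (if b then (x ∷ w) ∷ ws else ws)
      eq true  x ws = refl
      eq false x ws = refl

    extendWordsᵉ : ∀ K ws → length K ≤ N → length ws ≤ N → All (λ w → length w ≤ N) ws →
      Evaluates N extendWords (encodeVertices K ∙ encodeWords ws)
        (encodeWords (foldr (λ w vs → extensions K vs w) [] ws))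
    extendWordsᵉ K ws K≤N ws≤N short = foldᵉ encodeVertices
      (λ ys → encodeWords (foldr (λ w vs → extensions K vs w) [] ys)) (All (λ w → length w ≤ N))
      (λ { (_ ∷ ps) → ps }) short ws≤N (refl , _) (refl , _)
      λ { w ys (p ∷ _) → afterᵉ (refl , _) (extendWordᵉ K (foldr (λ w vs → extensions K vs w) [] ys) w K≤N p) }

    -- The words of every intermediate length j are folded over when they are extended, hence a
    -- bound for each j and not only for the full length.
    module _ (power≤N : ∀ {j} → j ≤ length kernelVertices → length kernelVertices ^ j ≤ N) where

      private
        K = kernelVertices

      K≤N : length K ≤ N
      K≤N = ≤-trans (kernel-length capacity (allFin n)) allFin≤N

      wordsOver≤N : ∀ {j} → j ≤ length K → length (wordsOver K j) ≤ N
      wordsOver≤N {j} j≤ = ≤-trans (length-wordsOver K j) (power≤N {j} j≤)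

      words-short : ∀ {j} {ws : List (List (Fin n))} → j ≤ length K → All (λ w → length w ≡ j) ws → All (λ w → length w ≤ N) ws
      words-short j≤ []          = []
      words-short j≤ (refl ∷ ps) = ≤-trans j≤ K≤N ∷ words-short j≤ ps

      makeWordsᵉ : Evaluates N makeWords (encodeVertices K) (encodeWords (wordsOver K (length K)))
      makeWordsᵉ = foldᵉ encodeVertex (λ ys → encodeWords (wordsOver K (length ys)))
        (λ ys → length ys ≤ length K) (≤-trans (n≤1+n _)) ≤-refl K≤N (refl , _) (refl , _)
        λ x ys p → afterᵉ (refl , _) (extendWordsᵉ K (wordsOver K (length ys)) K≤N
          (wordsOver≤N (≤-trans (n≤1+n _) p))
          (words-short (≤-trans (n≤1+n _) p) (wordsOver-length K (length ys))))

      encodeFirst : List (Fin n) → Tree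
      encodeFirst []      = nil
      encodeFirst (x ∷ _) = encodeVertex x

      budgetAfterᵉ : ∀ k w → length w ≤ N → Evaluates N budgetAfter (encodeℕ k ∙ encodeVertices w)
        (encodeList (drop (breaks core w) (replicate k nil)))
      budgetAfterᵉ k w w≤N = leftᵉ (foldᵉ′ encodeVertex
        (λ ys → encodeList (drop (breaks core ys) ts) ∙ encodeFirst ys) w≤N (refl , _) (refl , _) step)
        where
        ts = replicate k nil
        eq : ∀ b c → (if b then tail (encodeList (drop c ts)) else encodeList (drop c ts))
                   ≡ encodeList (drop (bit b + c) ts)
        eq true  c = tail-drop c ts
        eq false c = refl
        step : ∀ x ys → Evaluates N _ _ _
        step x []       = pairᵉ (branchᵉ (afterᵉ (refl , _) (noEdgeᵉ x)) refl (refl , _) (refl , _)) (refl , _)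
        step x (y ∷ ys) = pairᵉ
          (recast (trans (eq (core y x) (breaks core (y ∷ ys)))
              (cong (λ b → encodeList (drop (bit b + breaks core (y ∷ ys)) ts)) (core-symmetric y x)))
            (branchᵉ (afterᵉ (refl , _) (coreEdgeᵉ y x)) (truth-encodeBool (core y x)) (refl , _) (refl , _)))
          (refl , _)

      searchᵉ : ∀ k ws → length ws ≤ N → All (λ w → length w ≤ N) ws →
        Evaluates N search (encodeWords ws ∙ encodeℕ k) (encodeBool (any (λ w → breaks core w <ᵇ k) ws))
      searchᵉ k ws ws≤N short = foldᵉ encodeVertices (λ ys → encodeBool (any (λ w → breaks core w <ᵇ k) ys))
        (All (λ w → length w ≤ N)) (λ { (_ ∷ ps) → ps }) short ws≤N (refl , _) (refl , _)
        λ { w ys (p ∷ _) → recast (eq (breaks core w <ᵇ k) (any (λ w → breaks core w <ᵇ k) ys))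
          (branchᵉ (afterᵉ (refl , _) (budgetAfterᵉ k w p))
            (trans (truth-drop (breaks core w) (replicate k nil)) (cong (breaks core w <ᵇ_) (length-replicate k)))
            (refl , _) (refl , _)) }
        where
        eq : ∀ a b → (if a then (nil ∙ nil) else encodeBool b) ≡ encodeBool (a ∨ b)
        eq true  b = refl
        eq false b = refl

      antiPathCoverᵉ : ∀ k → Evaluates N antiPathCover (encodeGraph G ∙ encodeℕ k) (encodeBool (accepts k))
      antiPathCoverᵉ k = afterᵉ
        (pairᵉ
          (afterᵉ (afterᵉ (afterᵉ (makeVerticesᵉ (encodeℕ k)) (pairᵉ (refl , _) thresholdᵉ))
            (makeKernelᵉ capacity)) makeWordsᵉ)
          (refl , _))
        (searchᵉ k (wordsOver K (length K)) (wordsOver≤N ≤-refl)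
          (words-short ≤-refl (wordsOver-length K (length K))))

-- Counting in permuted and reversed lists

count-↭ : ∀ {A : Set} (p : A → Bool) {xs ys} → xs ↭ ys → count p xs ≡ count p ys
count-↭ p ↭.refl        = refl
count-↭ p (prep x e)   = cong (bit (p x) +_) (count-↭ p e)
count-↭ p {x ∷ y ∷ xs} {_ ∷ _ ∷ ys} (swap x y e) rewrite count-↭ p e =
  exchange (bit (p x)) (bit (p y)) (count p ys)
  where
  exchange : ∀ a b c → a + (b + c) ≡ b + (a + c)
  exchange = solve-∀
count-↭ p (↭.trans e e′) = trans (count-↭ p e) (count-↭ p e′)

count-++ : ∀ {A : Set} (p : A → Bool) xs ys → count p (xs ++ ys) ≡ count p xs + count p ys
count-++ p []       ys = refl
count-++ p (x ∷ xs) ys rewrite count-++ p xs ys = sym (+-assoc (bit (p x)) _ _)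

count-ʳ++ : ∀ {A : Set} (p : A → Bool) xs ys → count p (xs ʳ++ ys) ≡ count p xs + count p ys
count-ʳ++ p xs ys = trans (count-↭ p (↭-sym (++↭ʳ++ xs ys))) (count-++ p xs ys)

-- _ʳ++_ joins its arguments at their heads.
junction : ∀ {A : Set} → (A → A → Bool) → List A → List A → ℕ
junction p []      _       = 0
junction p (_ ∷ _) []      = 0
junction p (x ∷ _) (y ∷ _) = bit (p x y)

-- Orderings and breaks

Symmetricᵇ : {A : Set} → (A → A → Bool) → Set
Symmetricᵇ p = ∀ x y → p x y ≡ p y x

Arrangeable : {A : Set} → (A → A → Bool) → ℕ → List A → Set
Arrangeable p k S = ∃[ w ] w ↭ S × breaks p w < k

module _ {A : Set} {p : A → A → Bool} where

  breaks-∷ : ∀ x a b → breaks p (x ∷ b) ≡ junction p (x ∷ a) b + breaks p b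
  breaks-∷ x a []      = refl
  breaks-∷ x a (_ ∷ _) = refl

  module _ (p-sym : Symmetricᵇ p) where

    junction-sym : ∀ a b → junction p a b ≡ junction p b a
    junction-sym []      []      = refl
    junction-sym []      (_ ∷ _) = refl
    junction-sym (_ ∷ _) []      = refl
    junction-sym (x ∷ _) (y ∷ _) = cong bit (p-sym x y)

    -- An ordering with a marked position is written `a ʳ++ b`, where `a` is the part before it,
    -- backwards. Since `a` is read in the opposite direction, `p` has to be symmetric.
    breaks-ʳ++ : ∀ a b → breaks p (a ʳ++ b) ≡ breaks p a + (junction p a b + breaks p b)
    breaks-ʳ++ []      b = refl
    breaks-ʳ++ (x ∷ a) b = begin
      breaks p (a ʳ++ (x ∷ b))
        ≡⟨ breaks-ʳ++ a (x ∷ b) ⟩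
      breaks p a + (junction p a (x ∷ b) + breaks p (x ∷ b))
        ≡⟨ cong₂ (λ j k → breaks p a + (j + k)) (junction-sym a (x ∷ b)) (breaks-∷ x a b) ⟩
      breaks p a + (junction p (x ∷ b) a + (junction p (x ∷ a) b + breaks p b))
        ≡⟨ rearrange (breaks p a) (junction p (x ∷ b) a) (junction p (x ∷ a) b + breaks p b) ⟩
      junction p (x ∷ b) a + breaks p a + (junction p (x ∷ a) b + breaks p b)
        ≡⟨ cong (_+ (junction p (x ∷ a) b + breaks p b)) (breaks-∷ x b a) ⟨
      breaks p (x ∷ a) + (junction p (x ∷ a) b + breaks p b) ∎
      where
      open ≡-Reasoning
      rearrange : ∀ a b c → a + (b + c) ≡ b + a + c
      rearrange = solve-∀

    breaks-reverse : ∀ a → breaks p (reverse a) ≡ breaks p a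
    breaks-reverse a = trans (breaks-ʳ++ a [])
      (trans (cong (breaks p a +_) (trans (+-identityʳ _) (junction-sym a []))) (+-identityʳ _))

-- Removing a break by reversing a segment

module _ {A : Set} {adj : A → A → Bool} (adj-sym : Symmetricᵇ adj) where

  -- Reversing a segment v … x of a list u v … x y … turns the pairs (u , v) and
  -- (x , y) into (u , x) and (v , y).
  record Improvement (u v : A) (b : List A) : Set where
    field
      {x}            : A
      {front before suffix} : List A
      front-reversed : reverse (x ∷ before) ≡ v ∷ front
      splits         : (x ∷ before) ʳ++ suffix ≡ v ∷ b
      left-fits      : adj u x ≡ false
      right-fits     : junction adj (v ∷ front) suffix ≡ 0

  -- One and the same `w` has to serve two relations: for `adj` the number of breaks drops, and for
  -- `core` it must not grow. Both follow since the new pairs are non-adjacent, hence the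
  -- quantification over `p`.
  reverse-segment : ∀ {u v a b} → Improvement u v b →
    ∃[ w ] w ↭ (u ∷ a) ʳ++ (v ∷ b)
         × (∀ {p} → Symmetricᵇ p → (∀ x y → adj x y ≡ false → p x y ≡ false) →
            bit (p u v) + breaks p w ≤ breaks p ((u ∷ a) ʳ++ (v ∷ b)))
  reverse-segment {u} {v} {a} {b} improvement =
    (u ∷ a) ʳ++ (c ++ suffix) , permuted , improved
    where
    open Improvement improvement
    -- `c` runs from the end `x` of the segment back to `v`, so `c ++ suffix` contains the segment
    -- already reversed.
    c = x ∷ before
    permuted : (u ∷ a) ʳ++ (c ++ suffix) ↭ (u ∷ a) ʳ++ (v ∷ b)
    permuted = ↭-trans (↭-sym (++↭ʳ++ (u ∷ a) (c ++ suffix)))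
      (↭-trans (++⁺ˡ (u ∷ a) (↭-trans (++↭ʳ++ c suffix) (↭-reflexive splits)))
        (++↭ʳ++ (u ∷ a) (v ∷ b)))
    module _ {p : A → A → Bool} (p-sym : Symmetricᵇ p) (p⇒adj : ∀ x y → adj x y ≡ false → p x y ≡ false) where
      open ≤-Reasoning
      junction≡0 : ∀ xs ys → junction adj xs ys ≡ 0 → junction p xs ys ≡ 0
      junction≡0 []      ys      e = refl
      junction≡0 (_ ∷ _) []      e = refl
      junction≡0 (x ∷ _) (y ∷ _) e with adj x y in eq
      ... | false = cong bit (p⇒adj x y eq)
      new : breaks p (c ++ suffix) ≡ breaks p c + breaks p suffix
      new = begin-equality
        breaks p (c ++ suffix)            ≡⟨ cong (λ d → breaks p (d ++ suffix)) (reverse-involutive c) ⟨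
        breaks p (reverse (reverse c) ++ suffix) ≡⟨ cong (breaks p) (ʳ++-defn (reverse c)) ⟨
        breaks p (reverse c ʳ++ suffix)   ≡⟨ breaks-ʳ++ p-sym (reverse c) suffix ⟩
        breaks p (reverse c) + (junction p (reverse c) suffix + breaks p suffix)
          ≡⟨ cong₂ (λ m j → m + (j + breaks p suffix)) (breaks-reverse p-sym c)
                 (trans (cong (λ d → junction p d suffix) front-reversed) (junction≡0 (v ∷ front) suffix right-fits)) ⟩
        breaks p c + breaks p suffix      ∎
      old : breaks p c + breaks p suffix ≤ breaks p (v ∷ b)
      old = begin
        breaks p c + breaks p suffix                             ≤⟨ +-monoʳ-≤ (breaks p c) (m≤n+m _ _) ⟩
        breaks p c + (junction p c suffix + breaks p suffix)      ≡⟨ breaks-ʳ++ p-sym c suffix ⟨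
        breaks p (c ʳ++ suffix)                                  ≡⟨ cong (breaks p) splits ⟩
        breaks p (v ∷ b)                                        ∎
      improved : bit (p u v) + breaks p ((u ∷ a) ʳ++ (c ++ suffix)) ≤ breaks p ((u ∷ a) ʳ++ (v ∷ b))
      improved = begin
        bit (p u v) + breaks p ((u ∷ a) ʳ++ (c ++ suffix))
          ≡⟨ cong (bit (p u v) +_) (breaks-ʳ++ p-sym (u ∷ a) (c ++ suffix)) ⟩
        bit (p u v) + (breaks p (u ∷ a) + (bit (p u x) + breaks p (c ++ suffix)))
          ≡⟨ cong₂ (λ j k → bit (p u v) + (breaks p (u ∷ a) + (bit j + k))) (p⇒adj u x left-fits) new ⟩
        bit (p u v) + (breaks p (u ∷ a) + (breaks p c + breaks p suffix))
          ≡⟨ exchange (bit (p u v)) (breaks p (u ∷ a)) _ ⟩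
        breaks p (u ∷ a) + (bit (p u v) + (breaks p c + breaks p suffix))
          ≤⟨ +-monoʳ-≤ (breaks p (u ∷ a)) (+-monoʳ-≤ (bit (p u v)) old) ⟩
        breaks p (u ∷ a) + (bit (p u v) + breaks p (v ∷ b))
          ≡⟨ breaks-ʳ++ p-sym (u ∷ a) (v ∷ b) ⟨
        breaks p ((u ∷ a) ʳ++ (v ∷ b)) ∎
        where
        exchange : ∀ a b c → a + (b + c) ≡ b + (a + c)
        exchange = solve-∀

  -- Every `x` in `v ∷ b`, with successor `y`, is a candidate for the end of the segment. It fails
  -- only if `u` is adjacent to `x` or `v` is adjacent to `y`, and the last candidate only if `u` is
  -- adjacent to it. If all fail, each is charged to an edge at `u` or at `v`.
  improve-or-count : ∀ u v b →
    Improvement u v b ⊎ length (v ∷ b) ≤ count (adj u) (v ∷ b) + count (adj v) b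
  improve-or-count u v b = go v [] [] b refl refl
    where
    go : ∀ x before front suffix → reverse (x ∷ before) ≡ v ∷ front → (x ∷ before) ʳ++ suffix ≡ v ∷ b →
      Improvement u v b ⊎ length (x ∷ suffix) ≤ count (adj u) (x ∷ suffix) + count (adj v) suffix
    go x before front suffix e e′ with adj u x in ux
    go x before front [] e e′ | true = inj₂ ≤-refl
    go x before front [] e e′ | false = inj₁ (record
      { before = before ; suffix = [] ; front-reversed = e ; splits = e′ ; left-fits = ux ; right-fits = refl })
    go x before front (y ∷ suffix) e e′ | a
      with go y (x ∷ before) (front ++ y ∷ []) suffix (trans (unfold-reverse y (x ∷ before)) (cong (_++ y ∷ []) e)) e′
    ... | inj₁ i = inj₁ i
    ... | inj₂ l with a | adj v y in vy
    ...   | true  | b = inj₂ (s≤s (≤-trans l (+-monoʳ-≤ (count (adj u) (y ∷ suffix)) (m≤n+m _ (bit b)))))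
    ...   | false | true = inj₂ (≤-trans (s≤s l) (≤-reflexive (sym (+-suc (count (adj u) (y ∷ suffix)) _))))
    ...   | false | false = inj₁ (record
      { before = before ; suffix = y ∷ suffix ; front-reversed = e ; splits = e′ ; left-fits = ux ; right-fits = cong bit vy })

module _ {n} (G : Graph n) where

  open Graph G
  open Core G

  core-false : ∀ x y → adj x y ≡ false → core x y ≡ false
  core-false x y e with big x ∨ big y
  ... | true  = e
  ... | false = refl

  small-degree : ∀ {u} → big u ≡ false → 2 * degree u < n
  small-degree {u} e with 2 * degree u <ᵇ n in eq
  ... | true  = <ᵇ⇒< _ n (subst T (sym eq) _)

  -- Were no improvement possible on either side, deg u + deg v ≥ n would follow.
  remove-break : ∀ {u v a b} → (u ∷ a) ʳ++ (v ∷ b) ↭ allFin n →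
    adj u v ≡ true → big u ≡ false → big v ≡ false →
    ∃[ w ] w ↭ allFin n × breaks adj w < breaks adj ((u ∷ a) ʳ++ (v ∷ b))
         × breaks core w ≤ breaks core ((u ∷ a) ʳ++ (v ∷ b))
  remove-break {u} {v} {a} {b} perm uv u-small v-small
    with improve-or-count symmetric u v b | improve-or-count symmetric v u a
  ... | inj₁ i | _ =
    let w , perm′ , better = reverse-segment symmetric {a = a} i
    in w , ↭-trans perm′ perm ,
       subst (λ e → bit e + breaks adj w ≤ breaks adj ((u ∷ a) ʳ++ (v ∷ b))) uv (better symmetric (λ _ _ e → e)) ,
       ≤-trans (m≤n+m _ _) (better core-symmetric core-false)
  -- The other side of the break: the ordering is read backwards, and `u` and `v` change roles.
  ... | inj₂ _ | inj₁ i =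
    let w , perm′ , better = reverse-segment symmetric {a = b} i
        reversed : reverse ((u ∷ a) ʳ++ (v ∷ b)) ≡ (v ∷ b) ʳ++ (u ∷ a)
        reversed = trans (ʳ++-ʳ++ (u ∷ a)) (cong ((v ∷ b) ʳ++_) (++-identityʳ (u ∷ a)))
        same : ∀ {p} → Symmetricᵇ p → breaks p ((v ∷ b) ʳ++ (u ∷ a)) ≡ breaks p ((u ∷ a) ʳ++ (v ∷ b))
        same p-sym = trans (cong (breaks _) (sym reversed)) (breaks-reverse p-sym ((u ∷ a) ʳ++ (v ∷ b)))
    in w ,
       ↭-trans perm′ (↭-trans (↭-reflexive (sym reversed)) (↭-trans (↭-reverse _) perm)) ,
       subst₂ (λ e m → bit e + breaks adj w ≤ m) (trans (symmetric v u) uv) (same symmetric)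
         (better symmetric (λ _ _ e → e)) ,
       ≤-trans (m≤n+m _ _) (≤-trans (better core-symmetric core-false) (≤-reflexive (same core-symmetric)))
  ... | inj₂ l | inj₂ m = ⊥-elim (<-irrefl refl (begin-strict
    n                                       ≡⟨ length-tabulate id ⟨
    length (allFin n)                       ≡⟨ ↭-length perm ⟨
    length ((u ∷ a) ʳ++ (v ∷ b))            ≡⟨ length-ʳ++ (u ∷ a) ⟩
    length (u ∷ a) + length (v ∷ b)         ≤⟨ +-mono-≤ m l ⟩
    (count (adj v) (u ∷ a) + count (adj u) a) + (count (adj u) (v ∷ b) + count (adj v) b)
      ≤⟨ +-mono-≤ (+-monoʳ-≤ (count (adj v) (u ∷ a)) (m≤n+m _ _)) (+-monoʳ-≤ (count (adj u) (v ∷ b)) (m≤n+m _ _)) ⟩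
    (count (adj v) (u ∷ a) + count (adj u) (u ∷ a)) + (count (adj u) (v ∷ b) + count (adj v) (v ∷ b))
      ≡⟨ regroup (count (adj v) (u ∷ a)) _ _ _ ⟩
    (count (adj u) (u ∷ a) + count (adj u) (v ∷ b)) + (count (adj v) (u ∷ a) + count (adj v) (v ∷ b))
      ≡⟨ cong₂ _+_ (total u) (total v) ⟩
    degree u + degree v                     <⟨ *-cancelˡ-< 2 _ _ doubled ⟩
    n                                       ∎))
    where
    open ≤-Reasoning
    regroup : ∀ a b c d → (a + b) + (c + d) ≡ (b + c) + (a + d)
    regroup = solve-∀
    total : ∀ x → count (adj x) (u ∷ a) + count (adj x) (v ∷ b) ≡ degree x
    total x = trans (sym (count-ʳ++ (adj x) (u ∷ a) (v ∷ b))) (count-↭ (adj x) perm)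
    doubled : 2 * (degree u + degree v) < 2 * n
    doubled = begin-strict
      2 * (degree u + degree v)     ≡⟨ *-distribˡ-+ 2 (degree u) (degree v) ⟩
      2 * degree u + 2 * degree v   <⟨ +-mono-< (small-degree u-small) (small-degree v-small) ⟩
      n + n                         ≡⟨ cong (n +_) (sym (+-identityʳ n)) ⟩
      2 * n                         ∎

  -- The two counts can differ only by breaks with both ends outside H, so a scan that meets none of
  -- these proves the inequality.
  find-break : ∀ a x w → breaks adj (x ∷ w) ≤ breaks core (x ∷ w) ⊎
    ∃[ u ] ∃[ v ] ∃[ c ] ∃[ b ] (u ∷ c) ʳ++ (v ∷ b) ≡ a ʳ++ (x ∷ w)
      × adj u v ≡ true × big u ≡ false × big v ≡ false
  find-break a x []      = inj₁ z≤n
  find-break a x (y ∷ w) with find-break (x ∷ a) y w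
  ... | inj₂ found = inj₂ found
  ... | inj₁ fine with adj x y in xy | big x in bx | big y in by
  ...   | false | _     | _     = inj₁ (≤-trans fine (m≤n+m _ _))
  ...   | true  | true  | _     = inj₁ (s≤s fine)
  ...   | true  | false | true  = inj₁ (s≤s fine)
  ...   | true  | false | false = inj₂ (x , y , a , w , refl , xy , bx , by)

  -- Each removal lowers the number of breaks in G, which bounds the recursion by `m`, and never
  -- raises the number in the core. The final comparison is thus with the core breaks of the
  -- original `w`.
  remove-breaks : ∀ m w → w ↭ allFin n → breaks adj w ≤ m →
    ∃[ w′ ] w′ ↭ allFin n × breaks adj w′ ≤ breaks core w
  remove-breaks m []      perm _ = [] , perm , z≤n
  remove-breaks m (x ∷ w) perm l with find-break [] x w
  ... | inj₁ fine = x ∷ w , perm , fine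
  ... | inj₂ (u , v , c , b , e , uv , u-small , v-small)
    with w₁ , perm₁ , fewer , core≤ ← remove-break {u} {v} {c} {b}
           (↭-trans (↭-reflexive e) perm) uv u-small v-small
    with m | ≤-trans fewer (≤-trans (≤-reflexive (cong (breaks adj) e)) l)
  ... | suc m′ | s≤s l′ =
    let w₂ , perm₂ , le = remove-breaks m′ w₁ perm₁ l′
    in w₂ , perm₂ , ≤-trans le (≤-trans core≤ (≤-reflexive (cong (breaks core) e)))

  breaks-core : ∀ w → breaks core w ≤ breaks adj w
  breaks-core []          = z≤n
  breaks-core (x ∷ [])    = z≤n
  breaks-core (x ∷ y ∷ w) = +-mono-≤ (step (big x ∨ big y) (adj x y)) (breaks-core (y ∷ w))
    where
    step : ∀ a b → bit (a ∧ b) ≤ bit b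
    step true  b = ≤-refl
    step false b = z≤n

  core⇒adj : ∀ {k} → Arrangeable core k (allFin n) → Arrangeable adj k (allFin n)
  core⇒adj (w , perm , l) =
    let w′ , perm′ , l′ = remove-breaks _ w perm ≤-refl in w′ , perm′ , ≤-<-trans l′ l

  adj⇒core : ∀ {k S} → Arrangeable adj k S → Arrangeable core k S
  adj⇒core (w , perm , l) = w , perm , ≤-<-trans (breaks-core w) l

-- Twins and the kernel

Arrangeable-↭ : ∀ {A : Set} {p : A → A → Bool} {k S S′} → S ↭ S′ → Arrangeable p k S → Arrangeable p k S′
Arrangeable-↭ e (w , perm , l) = w , ↭-trans perm e , l

zipper-∈ : ∀ {A : Set} {v : A} {w} → v ∈ w → ∃[ c ] ∃[ d ] c ʳ++ (v ∷ d) ≡ w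
zipper-∈ = go []
  where
  go : ∀ {A : Set} {v : A} acc {w} → v ∈ w → ∃[ c ] ∃[ d ] c ʳ++ (v ∷ d) ≡ acc ʳ++ w
  go acc (here refl)    = acc , _ , refl
  go acc (there {x = x} i) = go (x ∷ acc) i

count-witness : ∀ {A : Set} (p : A → Bool) w → 0 < count p w → ∃[ u ] u ∈ w × p u ≡ true
count-witness p (x ∷ w) l with p x in eq
... | true  = x , here refl , eq
... | false with u , i , e ← count-witness p w l = u , there i , e

ʳ++-shift : ∀ {A : Set} (v : A) c d → c ʳ++ (v ∷ d) ↭ v ∷ (c ʳ++ d)
ʳ++-shift v c d = ↭-trans (↭-sym (++↭ʳ++ c (v ∷ d))) (↭-trans (shift v c d) (prep v (++↭ʳ++ c d)))

<ᵇ-false : ∀ {x y} → (x <ᵇ y) ≡ false → y ≤ x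
<ᵇ-false {x} e = ≮⇒≥ λ x<y → subst T e (<⇒<ᵇ x<y)

firstIs : ∀ {A : Set} → (A → Bool) → List A → Bool
firstIs h []      = false
firstIs h (x ∷ _) = h x

Quiet : ∀ {A : Set} → (A → Bool) → (A → Bool) → List A → Set
Quiet p h w = ∃[ a ] ∃[ z ] ∃[ b ] a ʳ++ (z ∷ b) ≡ w
  × p z ≡ true × firstIs h a ≡ false × firstIs h b ≡ false

module _ {A : Set} (p h : A → Bool) where

  -- An element of p that is not quiet is charged to a neighbour in h, or to itself if it is in h.
  quiet-or-few : ∀ w → Quiet p h w ⊎ count p w ≤ count h w * 3
  quiet-or-few w with go [] w
    where
    -- A member of `h` owns three units: for itself and for each neighbour. The bit on the left
    -- reserves the unit that the head of `w` owes to the element before it; the bit on the right is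
    -- the unit that the head of `acc` grants to the head of `w`.
    go : ∀ acc w → Quiet p h (acc ʳ++ w)
      ⊎ count p w + bit (firstIs h w) ≤ count h w * 3 + bit (firstIs h acc)
    go acc []      = inj₂ z≤n
    go acc (z ∷ b) with go (z ∷ acc) b
    ... | inj₁ q = inj₁ q
    ... | inj₂ l with p z in tw | h z in bz
    ...   | tz | true = inj₂ (begin
      bit tz + count p b + 1      ≤⟨ +-monoˡ-≤ 1 (+-mono-≤ (bit≤1 tz) (≤-trans (m≤m+n _ _) l)) ⟩
      1 + (count h b * 3 + 1) + 1       ≡⟨ sum-up (count h b) ⟩
      suc (count h b) * 3               ≤⟨ m≤m+n _ _ ⟩
      suc (count h b) * 3 + bit (firstIs h acc) ∎)
      where
      open ≤-Reasoning
      bit≤1 : ∀ b → bit b ≤ 1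
      bit≤1 true  = ≤-refl
      bit≤1 false = z≤n
      sum-up : ∀ m → 1 + (m * 3 + 1) + 1 ≡ suc m * 3
      sum-up = solve-∀
    ...   | false | false = inj₂ (begin
      count p b + 0                    ≡⟨ +-identityʳ _ ⟩
      count p b                        ≤⟨ m≤m+n _ _ ⟩
      count p b + bit (firstIs h b)     ≤⟨ l ⟩
      count h b * 3 + 0                      ≤⟨ +-monoʳ-≤ (count h b * 3) z≤n ⟩
      count h b * 3 + bit (firstIs h acc)     ∎)
      where open ≤-Reasoning
    ...   | true | false with firstIs h acc in fa | firstIs h b in fb
    ...     | false | false = inj₁ (acc , z , b , refl , tw , fa , fb)
    ...     | true  | _     = inj₂ (begin
      suc (count p b + 0)              ≡⟨ cong suc (+-identityʳ _) ⟩
      suc (count p b)                  ≤⟨ s≤s (≤-trans (m≤m+n _ _) l) ⟩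
      suc (count h b * 3 + 0)                ≡⟨ +-suc (count h b * 3) 0 ⟨
      count h b * 3 + 1                      ∎)
      where open ≤-Reasoning
    ...     | false | true  = inj₂ (begin
      suc (count p b + 0)              ≡⟨ +-suc (count p b) 0 ⟨
      count p b + 1                    ≤⟨ l ⟩
      count h b * 3 + 0                      ∎)
      where open ≤-Reasoning
  ... | inj₁ q = inj₁ q
  ... | inj₂ l = inj₂ (≤-trans (m≤m+n _ _) (≤-trans l (≤-reflexive (+-identityʳ _))))

module _ {n} (G : Graph n) where

  open Graph G
  open Core G

  twins⇒≡ : ∀ {u v} → twins u v ≡ true → ∀ x → core u x ≡ core v x
  twins⇒≡ {u} {v} e x = agree (core u x) (core v x)
    (All.lookup (All.all⁺ (λ x → not (core u x xor core v x)) (allFin n) (Equivalence.from T-≡ e)) (∈-allFin x))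
    where
    agree : ∀ a b → T (not (a xor b)) → a ≡ b
    agree true  true  _ = refl
    agree false false _ = refl

  core-irreflexive : ∀ v → core v v ≡ false
  core-irreflexive v rewrite loopless v with big v ∨ big v
  ... | true  = refl
  ... | false = refl

  -- `v` is placed right after a twin `u`. The pair is no break, because `core u v` equals
  -- `core v v`, and towards the next element `v` behaves as `u` did.
  insert-twin : ∀ {k v S} → 0 < count (twins v) S → Arrangeable core k S → Arrangeable core k (v ∷ S)
  insert-twin {k} {v} {S} twin (w , perm , l)
    with u , u∈w , tw ← count-witness (twins v) w (subst (0 <_) (sym (count-↭ (twins v) perm)) twin)
    with a , b , refl ← zipper-∈ u∈w =
    a ʳ++ (u ∷ v ∷ b) ,
    ↭-trans (↭-trans (ʳ++-shift u a (v ∷ b)) (prep u (ʳ++-shift v a b)))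
      (↭-trans (swap u v ↭-refl) (prep v (↭-trans (↭-sym (ʳ++-shift u a b)) perm))) ,
    subst (_< k) (sym unchanged) l
    where
    open ≡-Reasoning
    unchanged : breaks core (a ʳ++ (u ∷ v ∷ b)) ≡ breaks core (a ʳ++ (u ∷ b))
    unchanged = begin
      breaks core (a ʳ++ (u ∷ v ∷ b))
        ≡⟨ breaks-ʳ++ core-symmetric (u ∷ a) (v ∷ b) ⟩
      breaks core (u ∷ a) + (bit (core u v) + breaks core (v ∷ b))
        ≡⟨ cong₂ (λ e m → breaks core (u ∷ a) + (bit e + m)) uv (breaks-∷ v a b) ⟩
      breaks core (u ∷ a) + (junction core (v ∷ a) b + breaks core b)
        ≡⟨ cong (λ j → breaks core (u ∷ a) + (j + breaks core b)) (same b) ⟩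
      breaks core (u ∷ a) + (junction core (u ∷ a) b + breaks core b)
        ≡⟨ breaks-ʳ++ core-symmetric (u ∷ a) b ⟨
      breaks core (a ʳ++ (u ∷ b)) ∎
      where
      uv : core u v ≡ false
      uv = trans (sym (twins⇒≡ tw v)) (core-irreflexive v)
      same : ∀ b → junction core (v ∷ a) b ≡ junction core (u ∷ a) b
      same []      = refl
      same (x ∷ _) = cong bit (twins⇒≡ tw x)

  replace-twin : ∀ {v z} → twins v z ≡ true → ∀ c d →
    breaks core (c ʳ++ (z ∷ d)) ≡ breaks core (c ʳ++ (v ∷ d))
  replace-twin {v} {z} tw c d = begin
    breaks core (c ʳ++ (z ∷ d))                                        ≡⟨ expand z ⟩
    breaks core c + (junction core (z ∷ d) c + (junction core (z ∷ c) d + breaks core d))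
      ≡⟨ cong₂ (λ i j → breaks core c + (i + (j + breaks core d))) (same d c) (same c d) ⟨
    breaks core c + (junction core (v ∷ d) c + (junction core (v ∷ c) d + breaks core d))
      ≡⟨ expand v ⟨
    breaks core (c ʳ++ (v ∷ d))                                        ∎
    where
    open ≡-Reasoning
    same : ∀ e b → junction core (v ∷ e) b ≡ junction core (z ∷ e) b
    same e []      = refl
    same e (x ∷ _) = cong bit (twins⇒≡ tw x)
    expand : ∀ x → breaks core (c ʳ++ (x ∷ d))
      ≡ breaks core c + (junction core (x ∷ d) c + (junction core (x ∷ c) d + breaks core d))
    expand x = trans (breaks-ʳ++ core-symmetric c (x ∷ d))
      (cong₂ (λ i j → breaks core c + (i + j)) (junction-sym core-symmetric c (x ∷ d)) (breaks-∷ x c d))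

  -- The two elements brought together both lie outside H, and `core` has no edge between such
  -- vertices.
  remove-quiet : ∀ a z b → firstIs big a ≡ false → firstIs big b ≡ false →
    breaks core (a ʳ++ b) ≤ breaks core (a ʳ++ (z ∷ b))
  remove-quiet a z b fa fb = begin
    breaks core (a ʳ++ b)                                  ≡⟨ breaks-ʳ++ core-symmetric a b ⟩
    breaks core a + (junction core a b + breaks core b)    ≡⟨ cong (λ j → breaks core a + (j + breaks core b)) (no-break a b fa fb) ⟩
    breaks core a + breaks core b                          ≤⟨ +-monoʳ-≤ (breaks core a) (m≤n+m _ _) ⟩
    breaks core a + (junction core (z ∷ []) b + breaks core b)  ≡⟨ cong (breaks core a +_) (breaks-∷ z [] b) ⟨
    breaks core a + breaks core (z ∷ b)                    ≤⟨ +-monoʳ-≤ (breaks core a) (m≤n+m _ _) ⟩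
    breaks core a + (junction core a (z ∷ b) + breaks core (z ∷ b)) ≡⟨ breaks-ʳ++ core-symmetric a (z ∷ b) ⟨
    breaks core (a ʳ++ (z ∷ b))                            ∎
    where
    open ≤-Reasoning
    no-break : ∀ a b → firstIs big a ≡ false → firstIs big b ≡ false → junction core a b ≡ 0
    no-break []      b       _ _ = refl
    no-break (_ ∷ _) []      _ _ = refl
    no-break (x ∷ _) (y ∷ _) e f rewrite e | f = refl

  -- The quiet twin `z` may differ from the vertex `v` to be removed. In that case `z` is taken out
  -- of its place and put in the place of `v`.
  remove-twin : ∀ {k v S} → count big (v ∷ S) * 3 < count (twins v) (v ∷ S) →
    Arrangeable core k (v ∷ S) → Arrangeable core k S
  remove-twin {k} {v} {S} many (w , perm , l) with quiet-or-few (twins v) big w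
  ... | inj₂ few = contradiction
    (subst₂ (λ x y → x ≤ y * 3) (count-↭ (twins v) perm) (count-↭ big perm) few) (<⇒≱ many)
  ... | inj₁ (a , z , b , refl , tw , fa , fb) with ∈-resp-↭ (↭-sym (↭-trans (↭-sym (ʳ++-shift z a b)) perm)) (here refl)
  ...   | here refl = a ʳ++ b , drop-∷ (↭-trans (↭-sym (ʳ++-shift z a b)) perm) ,
                        ≤-<-trans (remove-quiet a z b fa fb) l
  ...   | there v∈ with c , d , e ← zipper-∈ v∈ =
    c ʳ++ (z ∷ d) ,
    drop-∷ (↭-trans (prep v (ʳ++-shift z c d)) (↭-trans (swap v z ↭-refl)
      (↭-trans (prep z (↭-trans (↭-sym (ʳ++-shift v c d)) (↭-reflexive e)))
        (↭-trans (↭-sym (ʳ++-shift z a b)) perm)))) ,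
    ≤-<-trans (≤-trans (≤-reflexive (trans (replace-twin tw c d) (cong (breaks core) e)))
      (remove-quiet a z b fa fb)) l

  count-kernel : ∀ (p : Fin n → Bool) m vs → count p (kernel m vs) ≤ count p vs
  count-kernel p m []       = z≤n
  count-kernel p m (v ∷ vs) with count (twins v) (kernel m vs) <ᵇ m
  ... | true  = +-monoʳ-≤ (bit (p v)) (count-kernel p m vs)
  ... | false = ≤-trans (count-kernel p m vs) (m≤n+m _ (bit (p v)))

  -- The list is reduced from its end, while `prefix`, the vertices not yet examined, is still
  -- complete. A vertex without room has at least `capacity` twins among the kept ones, and no
  -- intermediate set has more than `bigCount` big vertices, so a single capacity serves throughout.
  kernel-arrangeable : ∀ {k} prefix vs → count big (prefix ++ vs) ≤ bigCount →
    Arrangeable core k (prefix ++ kernel capacity vs) ⇔ Arrangeable core k (prefix ++ vs)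
  kernel-arrangeable         prefix []       few = mk⇔ id id
  kernel-arrangeable {k = k} prefix (v ∷ vs) few
    with kernel-arrangeable {k = k} (v ∷ prefix) vs
           (subst (_≤ bigCount) (count-↭ big (shift v prefix vs)) few)
       | count (twins v) (kernel capacity vs) <ᵇ capacity in room
  ... | ih | true  = mk⇔
    (Arrangeable-↭ (↭-sym (shift v prefix vs)) ∘ Equivalence.to ih ∘ Arrangeable-↭ (shift v prefix _))
    (Arrangeable-↭ (↭-sym (shift v prefix _)) ∘ Equivalence.from ih ∘ Arrangeable-↭ (shift v prefix vs))
  ... | ih | false = mk⇔
    (Arrangeable-↭ (↭-sym (shift v prefix vs)) ∘ Equivalence.to ih ∘ insert-twin (≤-trans (s≤s z≤n) full))
    (remove-twin many ∘ Equivalence.from ih ∘ Arrangeable-↭ (shift v prefix vs))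
    where
    S = prefix ++ kernel capacity vs
    full : capacity ≤ count (twins v) S
    full = ≤-trans (<ᵇ-false room) (≤-trans (m≤n+m _ (count (twins v) prefix)) (≤-reflexive (sym (count-++ (twins v) prefix _))))
    bounded : count big (v ∷ S) ≤ bigCount
    bounded = begin
      bit (big v) + count big S ≡⟨ cong (bit (big v) +_) (count-++ big prefix _) ⟩
      bit (big v) + (count big prefix + count big (kernel capacity vs))
        ≤⟨ +-monoʳ-≤ (bit (big v)) (+-monoʳ-≤ (count big prefix) (count-kernel big capacity vs)) ⟩
      bit (big v) + (count big prefix + count big vs) ≡⟨ cong (bit (big v) +_) (count-++ big prefix vs) ⟨
      count big (v ∷ prefix ++ vs) ≡⟨ count-↭ big (shift v prefix vs) ⟨
      count big (prefix ++ v ∷ vs) ≤⟨ few ⟩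
      bigCount ∎
      where open ≤-Reasoning
    many : count big (v ∷ S) * 3 < count (twins v) (v ∷ S)
    many = ≤-trans (s≤s (*-monoˡ-≤ 3 bounded)) (≤-trans full (m≤n+m _ (bit (twins v v))))

-- Orderings and path covers

module _ {A : Set} where

  Unique-↭ : {xs ys : List A} → xs ↭ ys → Unique xs → Unique ys
  Unique-↭ ↭.refl u = u
  Unique-↭ (prep x e) (p ∷ u) = All.tabulate (λ i → All.lookup p (∈-resp-↭ (↭-sym e) i)) ∷ Unique-↭ e u
  Unique-↭ (swap x y e) ((p ∷ p′) ∷ q ∷ u) =
    (p ∘ sym ∷ All.tabulate (λ i → All.lookup q (∈-resp-↭ (↭-sym e) i)))
    ∷ All.tabulate (λ i → All.lookup p′ (∈-resp-↭ (↭-sym e) i)) ∷ Unique-↭ e u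
  Unique-↭ (↭.trans e e′) u = Unique-↭ e′ (Unique-↭ e u)

  remaining : ∀ {x y : A} {zs} → x ≢ y → y ∈ x ∷ zs → y ∈ zs
  remaining x≢y (here y≡x) = contradiction (sym y≡x) x≢y
  remaining x≢y (there j)  = j

  -- The pigeonhole principle with an explicit remainder: the comparisons of lengths below are read
  -- off from `r`.
  complete-to-↭ : ∀ {w xs : List A} → Unique w → All (_∈ xs) w → ∃[ r ] w ++ r ↭ xs
  complete-to-↭ {xs = xs} [] [] = xs , ↭-refl
  complete-to-↭ {x ∷ w} (p ∷ u) (i ∷ is) with ys , zs , refl ← ∈-∃++ i
    with r , e ← complete-to-↭ u (All.tabulate λ y∈ → remaining (All.lookup p y∈) (∈-resp-↭ (shift x ys zs) (All.lookup is y∈)))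
    = r , ↭-trans (prep x e) (↭-sym (shift x ys zs))

  unique-length-≤ : ∀ {w xs : List A} → Unique w → All (_∈ xs) w → length w ≤ length xs
  unique-length-≤ {w} u is with r , e ← complete-to-↭ u is =
    ≤-trans (≤-trans (m≤m+n _ (length r)) (≤-reflexive (sym (length-++ w)))) (≤-reflexive (↭-length e))

  unique-full-↭ : ∀ {w xs : List A} → Unique w → All (_∈ xs) w → length xs ≤ length w → w ↭ xs
  unique-full-↭ {w} u is l with complete-to-↭ u is
  ... | []    , e = ↭-trans (↭-reflexive (sym (++-identityʳ w))) e
  ... | x ∷ r , e = contradiction l (<⇒≱ (≤-trans
    (≤-trans (m<m+n (length w) z<s) (≤-reflexive (sym (length-++ w)))) (≤-reflexive (↭-length e))))

  unique-covering-↭ : ∀ {w xs : List A} → Unique w → Unique xs → All (_∈ xs) w → All (_∈ w) xs → w ↭ xs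
  unique-covering-↭ u v is js = unique-full-↭ u is (unique-length-≤ v js)

  Unique-++⁻ : ∀ {xs ys : List A} → Unique (xs ++ ys) → Unique xs × Unique ys × Disjoint xs ys
  Unique-++⁻ {[]}     u       = [] , u , λ { (() , _) }
  Unique-++⁻ {x ∷ xs} (p ∷ u) with v , w , d ← Unique-++⁻ {xs} u =
    All.++⁻ˡ xs p ∷ v , w , λ
      { (here refl , j) → All.lookup (All.++⁻ʳ xs p) j refl
      ; (there i     , j) → d (i , j) }

  Unique-concat⁻ : ∀ {xss : List (List A)} → Unique (concat xss) → All Unique xss × AllPairs Disjoint xss
  Unique-concat⁻ {[]}       u = [] , []
  Unique-concat⁻ {xs ∷ xss} u with v , w , d ← Unique-++⁻ {xs} u | us , ds ← Unique-concat⁻ {xss} (proj₁ (proj₂ (Unique-++⁻ {xs} u))) =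
    v ∷ us , All.tabulate (λ { ys∈ (i , j) → d (i , ∈-concat⁺ (lose ys∈ j)) }) ∷ ds

module _ {n} (G : Graph n) where

  open Graph G
  open Graph (complement G) using () renaming (Adjacent to NonAdjacent)

  nonAdjacent⇒¬adj : ∀ {x y} → NonAdjacent x y → adj x y ≡ false
  nonAdjacent⇒¬adj {x} {y} e with distinct x y | adj x y
  ... | true | false = refl

  ¬adj⇒nonAdjacent : ∀ {x y} → x ≢ y → adj x y ≡ false → NonAdjacent x y
  ¬adj⇒nonAdjacent {x} {y} x≢y e rewrite e with x ≟ᶠ y
  ... | yes x≡y = contradiction x≡y x≢y
  ... | no  _   = refl

  breaks-path : ∀ {p} → Linked NonAdjacent p → breaks adj p ≡ 0
  breaks-path []      = refl
  breaks-path [-]     = refl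
  breaks-path (e ∷ l) = cong₂ (λ b m → bit b + m) (nonAdjacent⇒¬adj e) (breaks-path l)

  breaks-++ : ∀ xs ys → breaks adj (xs ++ ys) ≤ breaks adj xs + suc (breaks adj ys)
  breaks-++ []          ys       = n≤1+n _
  breaks-++ (x ∷ [])    []       = z≤n
  breaks-++ (x ∷ [])    (y ∷ ys) with adj x y
  ... | true  = ≤-refl
  ... | false = n≤1+n _
  breaks-++ (x ∷ y ∷ w) ys       = ≤-trans (+-monoʳ-≤ (bit (adj x y)) (breaks-++ (y ∷ w) ys))
    (≤-reflexive (sym (+-assoc (bit (adj x y)) _ _)))

  breaks-concat : ∀ {ps} → All (IsPath (complement G)) ps → breaks adj (concat ps) ≤ length ps ∸ 1
  breaks-concat []                     = z≤n
  breaks-concat {p ∷ []} (i ∷ [])      =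
    ≤-reflexive (trans (cong (breaks adj) (++-identityʳ p)) (breaks-path (IsPath.consecutive i)))
  breaks-concat {p ∷ q ∷ ps} (i ∷ is)  = ≤-trans (breaks-++ p (concat (q ∷ ps)))
    (subst (λ m → m + suc (breaks adj (concat (q ∷ ps))) ≤ suc (length ps))
      (sym (breaks-path (IsPath.consecutive i))) (s≤s (breaks-concat is)))

  -- Concatenated paths break only where two of them meet. Positivity of k matters for the empty
  -- graph, which is covered by no path at all although no ordering has fewer than 0 breaks.
  coverable⇒arrangeable : ∀ {k} .{{_ : NonZero k}} → PathCoverable k (complement G) → Arrangeable adj k (allFin n)
  coverable⇒arrangeable {suc k} (ps , paths , disjoint , covers , l) =
    concat ps ,
    unique-covering-↭ (Unique-concat (All.map IsPath.simple paths) disjoint) (allFin⁺ n)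
      (All.tabulate λ {v} _ → ∈-allFin v) (All.tabulate λ {v} _ → ∈-concat⁺ (covers v)) ,
    s≤s (≤-trans (breaks-concat paths) (∸-monoˡ-≤ 1 l))

  NonTrivialPath : List (Fin n) → Set
  NonTrivialPath p = p ≢ [] × Linked NonAdjacent p

  -- A new path begins after each break. Uniqueness enters because adjacency in the complement also
  -- requires distinct ends.
  cut : ∀ x w → Unique (x ∷ w) → ∃[ p ] ∃[ ps ] x ∷ w ≡ concat ((x ∷ p) ∷ ps)
    × Linked NonAdjacent (x ∷ p) × All NonTrivialPath ps × length ps ≤ breaks adj (x ∷ w)
  cut x []      u = [] , [] , refl , [-] , [] , z≤n
  cut x (y ∷ w) ((x≢y ∷ _) ∷ u) with p , ps , e , l , ls , m ← cut y w u with adj x y in xy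
  ... | true  = [] , (y ∷ p) ∷ ps , cong (x ∷_) e , [-] , ((λ ()) , l) ∷ ls , s≤s m
  ... | false = y ∷ p , ps , cong (x ∷_) e , ¬adj⇒nonAdjacent x≢y xy ∷ l , ls , m

  arrangeable⇒coverable : ∀ {k} → Arrangeable adj k (allFin n) → PathCoverable k (complement G)
  arrangeable⇒coverable ([] , perm , l) = [] , [] , [] , (λ v → contradiction (∈-resp-↭ (↭-sym perm) (∈-allFin v)) λ ()) , z≤n
  arrangeable⇒coverable {k} (x ∷ w , perm , l)
    with cut x w (Unique-↭ (↭-sym perm) (allFin⁺ n))
  ... | p , ps , e , linked , paths , m =
    (x ∷ p) ∷ ps ,
    All.map (λ ((ne , l) , u) → record { nonEmpty = ne ; consecutive = l ; simple = u })
      (All.zip (((λ ()) , linked) ∷ paths , proj₁ us)) ,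
    proj₂ us ,
    (λ v → ∈-concat⁻ ((x ∷ p) ∷ ps) (subst (v ∈_) e (∈-resp-↭ (↭-sym perm) (∈-allFin v)))) ,
    ≤-trans (s≤s m) l
    where
    us = Unique-concat⁻ {xss = (x ∷ p) ∷ ps} (subst Unique e (Unique-↭ (↭-sym perm) (allFin⁺ n)))

-- Soundness and completeness of the enumeration of words

module _ {n : ℕ} where

  sameIndex-≡ : ∀ {x y : Fin n} → sameIndex x y ≡ true → x ≡ y
  sameIndex-≡ {x} {y} e with toℕ x <ᵇ toℕ y in a | toℕ y <ᵇ toℕ x in b
  ... | false | false = toℕ-injective (≤-antisym (<ᵇ-false b) (<ᵇ-false a))

  <ᵇ-irrefl : ∀ m → (m <ᵇ m) ≡ false
  <ᵇ-irrefl zero    = refl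
  <ᵇ-irrefl (suc m) = <ᵇ-irrefl m

  sameIndex-refl : ∀ (x : Fin n) → sameIndex x x ≡ true
  sameIndex-refl x rewrite <ᵇ-irrefl (toℕ x) = refl

  fresh⇒distinct : ∀ {x : Fin n} w → fresh x w ≡ true → All (x ≢_) w
  fresh⇒distinct         []      _ = []
  fresh⇒distinct {x = x} (y ∷ w) e with sameIndex x y in xy
  ... | false = (λ { refl → contradiction (trans (sym xy) (sameIndex-refl x)) λ () }) ∷ fresh⇒distinct w e

  distinct⇒fresh : ∀ {x : Fin n} {w} → All (x ≢_) w → fresh x w ≡ true
  distinct⇒fresh []                      = refl
  distinct⇒fresh {x = x} {y ∷ w} (p ∷ ps) with sameIndex x y in xy
  ... | true  = contradiction (sameIndex-≡ xy) p
  ... | false = distinct⇒fresh ps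

  extensions-sound : ∀ (xs : List (Fin n)) {out w v} → v ∈ extensions xs out w →
    v ∈ out ⊎ ∃[ x ] x ∈ xs × fresh x w ≡ true × v ≡ x ∷ w
  extensions-sound []       i = inj₁ i
  extensions-sound (x ∷ xs) {out} {w} i with fresh x w in e
  extensions-sound (x ∷ xs) (here refl) | true = inj₂ (x , here refl , e , refl)
  extensions-sound (x ∷ xs) (there i)     | true with extensions-sound xs i
  ... | inj₁ j                = inj₁ j
  ... | inj₂ (y , j , f , eq) = inj₂ (y , there j , f , eq)
  extensions-sound (x ∷ xs) i | false with extensions-sound xs i
  ... | inj₁ j                = inj₁ j
  ... | inj₂ (y , j , f , eq) = inj₂ (y , there j , f , eq)

  extensions-keep : ∀ (xs : List (Fin n)) {out w v} → v ∈ out → v ∈ extensions xs out w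
  extensions-keep []       i = i
  extensions-keep (x ∷ xs) {w = w} i with fresh x w
  ... | true  = there (extensions-keep xs i)
  ... | false = extensions-keep xs i

  extensions-complete : ∀ {xs : List (Fin n)} {out w x} → x ∈ xs → fresh x w ≡ true → (x ∷ w) ∈ extensions xs out w
  extensions-complete {w = w} {x} (here refl) f rewrite f = here refl
  extensions-complete {y ∷ xs} {w = w} (there i) f with fresh y w
  ... | true  = there (extensions-complete i f)
  ... | false = extensions-complete i f

  wordsOver-sound : ∀ xs j {w : List (Fin n)} → w ∈ wordsOver xs j → Unique w × All (_∈ xs) w
  wordsOver-sound xs zero    (here refl) = [] , []
  wordsOver-sound xs (suc j) i = go (wordsOver xs j) (wordsOver-sound xs j) i
    where
    go : ∀ ws {v} → (∀ {w} → w ∈ ws → Unique w × All (_∈ xs) w) →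
      v ∈ foldr (λ w vs → extensions xs vs w) [] ws → Unique v × All (_∈ xs) v
    go (w ∷ ws) ih i with extensions-sound xs i
    ... | inj₁ j = go ws (ih ∘ there) j
    ... | inj₂ (x , x∈ , f , refl) with u , is ← ih (here refl) = fresh⇒distinct w f ∷ u , x∈ ∷ is

  wordsOver-complete : ∀ xs {w : List (Fin n)} → Unique w → All (_∈ xs) w → w ∈ wordsOver xs (length w)
  wordsOver-complete xs []      []       = here refl
  wordsOver-complete xs {x ∷ w} (p ∷ u) (i ∷ is) = go (wordsOver-complete xs u is)
    where
    go : ∀ {ws} → w ∈ ws → (x ∷ w) ∈ foldr (λ w vs → extensions xs vs w) [] ws
    go (here refl) = extensions-complete i (distinct⇒fresh p)
    go (there j)     = extensions-keep xs (go j)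

module _ {n} (G : Graph n) where

  open Graph G
  open Core G

  private
    K = kernelVertices

  kernel-unique : ∀ m {vs} → Unique vs → Unique (kernel m vs) × All (_∈ vs) (kernel m vs)
  kernel-unique m []                 = [] , []
  kernel-unique m {v ∷ vs} (p ∷ u) with w , is ← kernel-unique m u with count (twins v) (kernel m vs) <ᵇ m
  ... | true  = All.map (All.lookup p) is ∷ w , here refl ∷ All.map there is
  ... | false = w , All.map there is

  -- A word over K without repetitions that is as long as K is a permutation of K, so the words
  -- tested are precisely the orderings of the kernel.
  accepts⇔arrangeable : ∀ k → accepts k ≡ true ⇔ Arrangeable core k K
  accepts⇔arrangeable k = mk⇔ to from
    where
    test : List (Fin n) → Bool
    test w = breaks core w <ᵇ k
    to : accepts k ≡ true → Arrangeable core k K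
    to e with w , w∈ , t ← find (any⁻ test (wordsOver K (length K)) (Equivalence.from T-≡ e))
      with u , is ← wordsOver-sound K (length K) w∈ =
      w , unique-full-↭ u is (≤-reflexive (sym (All.lookup (wordsOver-length K (length K)) w∈))) , <ᵇ⇒< _ k t
    from : Arrangeable core k K → accepts k ≡ true
    from (w , perm , l) = Equivalence.to T-≡ (any⁺ test (lose
      (subst (λ j → w ∈ wordsOver K j) (↭-length perm)
        (wordsOver-complete K (Unique-↭ (↭-sym perm) (proj₁ (kernel-unique capacity (allFin⁺ n))))
          (All.tabulate (∈-resp-↭ perm))))
      (<⇒<ᵇ l)))

  accepts-correct : ∀ k .{{_ : NonZero k}} → accepts k ≡ true ⇔ PathCoverable k (complement G)
  accepts-correct k = mk⇔
    (arrangeable⇒coverable G ∘ core⇒adj G ∘ Equivalence.to kernel⇔all ∘ Equivalence.to (accepts⇔arrangeable k))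
    (Equivalence.from (accepts⇔arrangeable k) ∘ Equivalence.from kernel⇔all ∘ adj⇒core G ∘ coverable⇒arrangeable G)
    where
    kernel⇔all : Arrangeable core k K ⇔ Arrangeable core k (allFin n)
    kernel⇔all = kernel-arrangeable G [] (allFin n) ≤-refl

-- The size of the kernel

module _ {A : Set} where

  select : (A → Bool) → List A → List A
  select p = filter (T? ∘ p)

  length-select : ∀ p xs → length (select p xs) ≡ count p xs
  length-select p []       = refl
  length-select p (x ∷ xs) with p x
  ... | true  = cong suc (length-select p xs)
  ... | false = length-select p xs

  count-select : ∀ (q p : A → Bool) xs → count q (select p xs) ≤ count q xs
  count-select q p []       = z≤n
  count-select q p (x ∷ xs) with p x
  ... | true  = +-monoʳ-≤ (bit (q x)) (count-select q p xs)
  ... | false = ≤-trans (count-select q p xs) (m≤n+m _ (bit (q x)))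

  ∈-select : ∀ p xs {x} → x ∈ select p xs → x ∈ xs × p x ≡ true
  ∈-select p xs i with j , t ← ∈-filter⁻ (T? ∘ p) i = j , Equivalence.to T-≡ t

  count-complement : ∀ (p : A → Bool) xs → count p xs + count (not ∘ p) xs ≡ length xs
  count-complement p []       = refl
  count-complement p (x ∷ xs) with p x
  ... | true  = cong suc (count-complement p xs)
  ... | false = trans (+-suc _ _) (cong suc (count-complement p xs))

  count-monotone : ∀ {p q : A → Bool} → (∀ x → p x ≡ true → q x ≡ true) → ∀ xs → count p xs ≤ count q xs
  count-monotone         f []       = z≤n
  count-monotone {p} {q} f (x ∷ xs) with p x in px
  ... | true  rewrite f x px = s≤s (count-monotone f xs)
  ... | false = ≤-trans (count-monotone f xs) (m≤n+m _ (bit (q x)))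

  count-all : ∀ {p : A → Bool} {xs} → All (λ x → p x ≡ true) xs → count p xs ≡ length xs
  count-all []                 = refl
  count-all {p} {x ∷ xs} (e ∷ es) rewrite e = cong suc (count-all es)

  count-injective : ∀ {B : Set} (ι : A → B) → (∀ {x y} → ι x ≡ ι y → x ≡ y) →
    ∀ (p : A → Bool) {xs ys} → Unique xs → (∀ x → p x ≡ true → ι x ∈ ys) → count p xs ≤ length ys
  count-injective ι inj p {xs} {ys} u f = begin
    count p xs                     ≡⟨ length-select p xs ⟨
    length (select p xs)           ≡⟨ length-map ι (select p xs) ⟨
    length (map ι (select p xs))   ≤⟨ unique-length-≤ (Unique-map inj (filter⁺ (T? ∘ p) u)) (All.tabulate within) ⟩
    length ys                      ∎
    where
    open ≤-Reasoning
    within : ∀ {y} → y ∈ map ι (select p xs) → y ∈ ys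
    within i with x , j , refl ← ∈-map⁻ ι i = f x (proj₂ (∈-select p xs j))

  total : (A → ℕ) → List A → ℕ
  total f xs = sum (map f xs)

  total-≤ : ∀ {f g : A → ℕ} → (∀ x → f x ≤ g x) → ∀ xs → total f xs ≤ total g xs
  total-≤ l []       = z≤n
  total-≤ l (x ∷ xs) = +-mono-≤ (l x) (total-≤ l xs)

  total-+ : ∀ (f g : A → ℕ) xs → total (λ x → f x + g x) xs ≡ total f xs + total g xs
  total-+ f g []       = refl
  total-+ f g (x ∷ xs) rewrite total-+ f g xs = interchange (f x) (g x) (total f xs) (total g xs)
    where
    interchange : ∀ a b c d → (a + b) + (c + d) ≡ (a + c) + (b + d)
    interchange = solve-∀

  total-const : ∀ m (xs : List A) → total (λ _ → m) xs ≡ length xs * m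
  total-const m []       = refl
  total-const m (x ∷ xs) = cong (m +_) (total-const m xs)

-- Double counting of the related pairs.
total-count-swap : ∀ {A B : Set} (a : A → B → Bool) xs ys →
  total (λ x → count (a x) ys) xs ≡ total (λ y → count (λ x → a x y) xs) ys
total-count-swap a []       ys = sym (trans (total-const 0 ys) (*-zeroʳ (length ys)))
total-count-swap a (x ∷ xs) ys = begin
  count (a x) ys + total (λ x → count (a x) ys) xs
    ≡⟨ cong₂ _+_ (count≡total ys) (total-count-swap a xs ys) ⟩
  total (bit ∘ a x) ys + total (λ y → count (λ x → a x y) xs) ys
    ≡⟨ total-+ (bit ∘ a x) (λ y → count (λ x → a x y) xs) ys ⟨
  total (λ y → count (λ x → a x y) (x ∷ xs)) ys ∎
  where
  open ≡-Reasoning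
  count≡total : ∀ ys → count (a x) ys ≡ total (bit ∘ a x) ys
  count≡total []       = refl
  count≡total (y ∷ ys) = cong (bit (a x y) +_) (count≡total ys)

-- Ancestors in a forest, and the number of edges and of big vertices

module Ancestors {m} (F : RootedForest m) where

  open RootedForest F

  -- The first argument is fuel, as climbing along `parent` is not structurally recursive. With
  -- `depth v` as fuel no proper ancestor of `v` is missed.
  ancestorsUpTo : ℕ → Fin m → List (Fin m)
  ancestorsUpTo zero    v = []
  ancestorsUpTo (suc k) v with parent v
  ... | nothing = []
  ... | just u  = u ∷ ancestorsUpTo k u

  ancestors : Fin m → List (Fin m)
  ancestors v = ancestorsUpTo (depth v) v

  length-ancestorsUpTo : ∀ k v → length (ancestorsUpTo k v) ≤ k
  length-ancestorsUpTo zero    v = z≤n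
  length-ancestorsUpTo (suc k) v with parent v
  ... | nothing = z≤n
  ... | just u  = s≤s (length-ancestorsUpTo k u)

  depth<height+1 : ∀ v → depth v < height+1
  depth<height+1 v = All.lookup (xs≤max 0 (map (suc ∘ depth) (allFin m))) (∈-map⁺ (suc ∘ depth) (∈-allFin v))

  parent-∈ : ∀ {u v k} → depth v ≡ k → IsParentOf u v → u ∈ ancestorsUpTo k v
  parent-∈ {k = zero}  e q with () ← trans (sym (depth-child q)) e
  parent-∈ {k = suc k} e q rewrite q = here refl

  ancestors-closed : ∀ {u y v k} → depth v ≡ k → IsParentOf u y → y ∈ ancestorsUpTo k v → u ∈ ancestorsUpTo k v
  ancestors-closed {v = v} {suc k} e q i with parent v in pv
  ancestors-closed {v = v} {suc k} e q (here refl) | just w =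
    there (parent-∈ (suc-injective (trans (sym (depth-child pv)) e)) q)
  ancestors-closed {v = v} {suc k} e q (there i)   | just w =
    there (ancestors-closed (suc-injective (trans (sym (depth-child pv)) e)) q i)

  ∈-ancestors : ∀ {u v} → ProperAncestor u v → u ∈ ancestors v
  ∈-ancestors [ q ]   = parent-∈ refl q
  ∈-ancestors (q ∷ c) = ancestors-closed refl q (∈-ancestors c)

module _ {n} (G : Graph n) where

  open Graph G
  open Core G

  -- Each neighbour of a vertex is mapped to an ancestor or a descendant of its image. Pairs of both
  -- kinds are counted at their lower end, where there are fewer than d ancestors to choose from.
  total-degree : ∀ {d} → HasTreeDepth G d → total degree (allFin n) ≤ 2 * (n * d)
  total-degree ((m , F , sub , refl) , _) = begin
    total degree V
      ≤⟨ total-≤ (λ u → count-or (above u) (below u) (edge-or u) V) V ⟩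
    total (λ u → count (above u) V + count (below u) V) V
      ≡⟨ total-+ (λ u → count (above u) V) (λ u → count (below u) V) V ⟩
    total (λ u → count (above u) V) V + total (λ u → count (below u) V) V
      ≡⟨ cong (_+ total (λ u → count (below u) V) V) (total-count-swap above V V) ⟩
    total (λ v → count (λ u → above u v) V) V + total (λ u → count (below u) V) V
      ≤⟨ +-mono-≤ few few ⟩
    n * D + n * D
      ≡⟨ cong (n * D +_) (+-identityʳ (n * D)) ⟨
    2 * (n * D) ∎
    where
    open ≤-Reasoning
    open SubgraphOfClosure sub
    open Ancestors F
    V = allFin n
    D = RootedForest.height+1 F
    above below : Fin n → Fin n → Bool
    above u v = ⌊ _∈?_ _≟ᶠ_ (ι u) (ancestors (ι v)) ⌋
    below u v = above v u
    above-∈ : ∀ u v → above u v ≡ true → ι u ∈ ancestors (ι v)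
    above-∈ u v e = toWitness (Equivalence.from T-≡ e)
    ∈-above : ∀ u v → ι u ∈ ancestors (ι v) → above u v ≡ true
    ∈-above u v i = Equivalence.to T-≡ (fromWitness i)
    edge-or : ∀ u v → adj u v ≡ true → above u v ≡ true ⊎ below u v ≡ true
    edge-or u v e with ι-edge e
    ... | inj₁ a = inj₁ (∈-above u v (∈-ancestors a))
    ... | inj₂ a = inj₂ (∈-above v u (∈-ancestors a))
    count-or : ∀ {r : Fin n → Bool} (p q : Fin n → Bool) → (∀ v → r v ≡ true → p v ≡ true ⊎ q v ≡ true) →
      ∀ vs → count r vs ≤ count p vs + count q vs
    count-or         p q f []       = z≤n
    count-or {r} p q f (v ∷ vs) = ≤-trans
      (+-mono-≤ (bit-or (r v) (p v) (q v) (f v)) (count-or p q f vs))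
      (≤-reflexive (interchange (bit (p v)) (bit (q v)) (count p vs) (count q vs)))
      where
      interchange : ∀ a b c d → (a + b) + (c + d) ≡ (a + c) + (b + d)
      interchange = solve-∀
      bit-or : ∀ a b c → (a ≡ true → b ≡ true ⊎ c ≡ true) → bit a ≤ bit b + bit c
      bit-or false b c f = z≤n
      bit-or true  b c f with f refl
      ... | inj₁ refl = s≤s z≤n
      ... | inj₂ refl = m≤n+m 1 (bit b)
    few : total (λ v → count (λ u → above u v) V) V ≤ n * D
    few = ≤-trans
      (total-≤ (λ v → ≤-trans
        (count-injective ι ι-injective (λ u → above u v) (allFin⁺ n) (λ u → above-∈ u v))
        (≤-trans (length-ancestorsUpTo (RootedForest.depth F (ι v)) (ι v)) (<⇒≤ (depth<height+1 (ι v))))) V)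
      (≤-reflexive (trans (total-const D V) (cong (_* D) {y = n} (length-tabulate id))))

  -- Markov's inequality: a big vertex contributes at least n to twice the sum of the degrees.
  big-degree : ∀ vs → n * count big vs ≤ 2 * total degree vs
  big-degree []       = ≤-reflexive (*-zeroʳ n)
  big-degree (v ∷ vs) with 2 * degree v <ᵇ n in bv
  ... | true  = ≤-trans (big-degree vs) (*-monoʳ-≤ 2 (m≤n+m _ (degree v)))
  ... | false = begin
    n * suc (count big vs)                ≡⟨ *-suc n _ ⟩
    n + n * count big vs                  ≤⟨ +-mono-≤ (<ᵇ-false bv) (big-degree vs) ⟩
    2 * degree v + 2 * total degree vs    ≡⟨ *-distribˡ-+ 2 (degree v) _ ⟨
    2 * (degree v + total degree vs)      ∎
    where open ≤-Reasoning

  twins-intro : ∀ {u v} → (∀ x → core u x ≡ core v x) → twins u v ≡ true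
  twins-intro {u} {v} f = Equivalence.to T-≡ (All.all⁻ (λ x → not (core u x xor core v x))
    (All.tabulate {xs = allFin n} λ {x} _ → agree (core u x) (core v x) (f x)))
    where
    agree : ∀ a b → a ≡ b → T (not (a xor b))
    agree true  _ refl = _
    agree false _ refl = _

  -- Room is tested only for the class of the vertex being added. If this vertex is a twin of `u`,
  -- the two classes coincide; otherwise the count for `u` stays as it was.
  kernel-twins : ∀ m vs u → count (twins u) (kernel m vs) ≤ m
  kernel-twins m []       u = z≤n
  kernel-twins m (v ∷ vs) u with count (twins v) (kernel m vs) <ᵇ m in room
  ... | false = kernel-twins m vs u
  ... | true with twins u v in uv
  ...   | false = kernel-twins m vs u
  ...   | true  = ≤-trans (s≤s (count-monotone same (kernel m vs)))
                    (<ᵇ⇒< (count (twins v) (kernel m vs)) m (Equivalence.from T-≡ room))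
    where
    same : ∀ x → twins u x ≡ true → twins v x ≡ true
    same x e = twins-intro λ y → trans (sym (twins⇒≡ G uv y)) (twins⇒≡ G e y)

  -- Every column of hs at most doubles the number of classes of twins.
  few-classes : ∀ m hs xs →
    (∀ {u v} → u ∈ xs → v ∈ xs → (∀ {h} → h ∈ hs → core u h ≡ core v h) → twins u v ≡ true) →
    (∀ u → count (twins u) xs ≤ m) → length xs ≤ 2 ^ length hs * m
  few-classes m []       []       sep few = z≤n
  few-classes m []       (u ∷ xs) sep few = begin
    length (u ∷ xs)          ≡⟨ count-all (All.tabulate λ i → sep (here refl) i λ ()) ⟨
    count (twins u) (u ∷ xs) ≤⟨ few u ⟩
    m                        ≡⟨ *-identityˡ m ⟨
    1 * m                    ∎
    where open ≤-Reasoning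
  few-classes m (h ∷ hs) xs sep few = begin
    length xs                                ≡⟨ count-complement p xs ⟨
    count p xs + count (not ∘ p) xs          ≡⟨ cong₂ _+_ (length-select p xs) (length-select (not ∘ p) xs) ⟨
    length (select p xs) + length (select (not ∘ p) xs)
      ≤⟨ +-mono-≤ (half p λ e e′ → trans e (sym e′)) (half (not ∘ p) λ {u} {v} e e′ → not-injective (p u) (p v) (trans e (sym e′))) ⟩
    2 ^ length hs * m + 2 ^ length hs * m    ≡⟨ double (2 ^ length hs) m ⟩
    2 ^ length (h ∷ hs) * m                  ∎
    where
    open ≤-Reasoning
    p : Fin n → Bool
    p u = core u h
    double : ∀ a m → a * m + a * m ≡ (2 * a) * m
    double = solve-∀
    not-injective : ∀ a b → not a ≡ not b → a ≡ b
    not-injective true  true  _ = refl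
    not-injective false false _ = refl
    half : ∀ q → (∀ {u v} → q u ≡ true → q v ≡ true → p u ≡ p v) → length (select q xs) ≤ 2 ^ length hs * m
    half q same = few-classes m hs (select q xs)
      (λ i j agree → sep (proj₁ (∈-select q xs i)) (proj₁ (∈-select q xs j)) λ
        { (here refl) → same (proj₂ (∈-select q xs i)) (proj₂ (∈-select q xs j))
        ; (there k)   → agree k })
      (λ u → ≤-trans (count-select (twins u) q xs) (few u))

  -- Outside H, a row of `core` is determined by its entries in the columns of H. This fails for the
  -- rows of H, whose vertices are therefore counted one by one.
  kernel-size : length kernelVertices ≤ bigCount + 2 ^ bigCount * capacity
  kernel-size = begin
    length K                                   ≡⟨ count-complement big K ⟨
    count big K + count (not ∘ big) K          ≡⟨ cong (count big K +_) (length-select (not ∘ big) K) ⟨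
    count big K + length (select (not ∘ big) K)
      ≤⟨ +-mono-≤ (count-kernel G big capacity (allFin n))
           (few-classes capacity (select big (allFin n)) (select (not ∘ big) K) separated
             (λ u → ≤-trans (count-select (twins u) (not ∘ big) K) (kernel-twins capacity (allFin n) u))) ⟩
    bigCount + 2 ^ length (select big (allFin n)) * capacity
      ≡⟨ cong (λ b → bigCount + 2 ^ b * capacity) (length-select big (allFin n)) ⟩
    bigCount + 2 ^ bigCount * capacity ∎
    where
    open ≤-Reasoning
    K = kernelVertices
    separated : ∀ {u v} → u ∈ select (not ∘ big) K → v ∈ select (not ∘ big) K →
      (∀ {h} → h ∈ select big (allFin n) → core u h ≡ core v h) → twins u v ≡ true
    separated {u} {v} i j agree = twins-intro equalRows
      where
      not-true : ∀ {b} → not b ≡ true → b ≡ false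
      not-true {false} _ = refl
      equalRows : ∀ x → core u x ≡ core v x
      equalRows x with big x in bx
      ... | true  = trans (cong (λ b → (big u ∨ b) ∧ adj u x) (sym bx))
                      (trans (agree (∈-filter⁺ (T? ∘ big) (∈-allFin x) (Equivalence.from T-≡ bx)))
                        (cong (λ b → (big v ∨ b) ∧ adj v x) bx))
      ... | false rewrite not-true (proj₂ (∈-select (not ∘ big) K i)) | not-true (proj₂ (∈-select (not ∘ big) K j)) = refl

-- One factor 2 stems from the threshold n/2, the other from counting each edge at both ends.
-- Cancelling n requires the empty graph to be treated apart.
big-count : ∀ {n} (G : Graph n) {d} → HasTreeDepth G d → Core.bigCount G ≤ 4 * d
big-count {zero}      G h = z≤n
big-count {n@(suc _)} G {d} h = *-cancelˡ-≤ n (begin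
  n * Core.bigCount G                 ≤⟨ big-degree G (allFin n) ⟩
  2 * total (Core.degree G) (allFin n) ≤⟨ *-monoʳ-≤ 2 (total-degree G h) ⟩
  2 * (2 * (n * d))                   ≡⟨ rearrange n d ⟩
  n * (4 * d)                         ∎)
  where
  open ≤-Reasoning
  rearrange : ∀ n d → 2 * (2 * (n * d)) ≡ n * (4 * d)
  rearrange = solve-∀

-- The time bound as a function of the tree-depth

kernelBound : ℕ → ℕ
kernelBound d = 4 * d + 2 ^ (4 * d) * suc (4 * d * 3)

kernel-bound : ∀ {n} (G : Graph n) {d} → HasTreeDepth G d → length (Core.kernelVertices G) ≤ kernelBound d
kernel-bound G h = ≤-trans (kernel-size G)
  (+-mono-≤ (big-count G h) (*-mono-≤ (^-monoʳ-≤ 2 (big-count G h)) (s≤s (*-monoˡ-≤ 3 (big-count G h)))))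

-- The strict inequality makes the base `m` positive, so that its powers grow with the exponent even
-- if `l` is 0.
^-bound : ∀ {l m j} → l < m → j ≤ l → l ^ j ≤ m ^ m
^-bound {l} {suc m} {j} (s≤s l≤m) j≤l =
  ≤-trans (^-monoˡ-≤ j (m≤n⇒m≤1+n l≤m)) (^-monoʳ-≤ (suc m) (≤-trans j≤l (m≤n⇒m≤1+n l≤m)))

^-distrib-* : ∀ e a b → (a * b) ^ e ≡ a ^ e * b ^ e
^-distrib-* zero    a b = refl
^-distrib-* (suc e) a b = trans (cong (a * b *_) (^-distrib-* e a b))
  ([m*n]*[o*p]≡[m*o]*[n*p] a b (a ^ e) (b ^ e))

module _ (w e : ℕ) where

  -- All folds are bounded by N = `m ^ m * suc n` with `m = suc (kernelBound d)`; this is the part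
  -- of `w * N ^ e` that depends on d alone.
  coefficient : ℕ → ℕ
  coefficient d = w * (suc (kernelBound d) ^ suc (kernelBound d)) ^ e

  coefficient-computable : Computable coefficient
  coefficient-computable = run coefficientF 0 , λ m → time coefficientF (encodeℕ m) ,
    subst (λ v → Computes run coefficientF 0 on encodeℕ m inTime time coefficientF (encodeℕ m) output v)
      (coefficientF-correct m) (computes coefficientF (encodeℕ m))
    where
    fourD kernelF sucKernelF coefficientF : Fn
    fourD        = numeral 4 *ᶠ input
    kernelF      = fourD +ᶠ ((numeral 2 ^ᶠ fourD) *ᶠ (numeral 1 +ᶠ (fourD *ᶠ numeral 3)))
    sucKernelF   = numeral 1 +ᶠ kernelF
    coefficientF = numeral w *ᶠ ((sucKernelF ^ᶠ sucKernelF) ^ᶠ numeral e)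

    coefficientF-correct : ∀ m → ⟦ coefficientF ⟧ (encodeℕ m) ≡ encodeℕ (coefficient m)
    coefficientF-correct m =
      *ᶠ-correct {numeral w} {(sucKernelF ^ᶠ sucKernelF) ^ᶠ numeral e} {t} {w} (numeral-correct w t) 
        (^ᶠ-correct {sucKernelF ^ᶠ sucKernelF} {numeral e} {t}
          (^ᶠ-correct {sucKernelF} {sucKernelF} {t} sucKernel sucKernel) (numeral-correct e t))
      where
      t = encodeℕ m
      four : ⟦ fourD ⟧ t ≡ encodeℕ (4 * m)
      four = *ᶠ-correct {numeral 4} {input} {t} {4} {m} refl refl
      sucKernel : ⟦ sucKernelF ⟧ t ≡ encodeℕ (suc (kernelBound m))
      sucKernel = +ᶠ-correct {numeral 1} {kernelF} {t} {1} refl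
        (+ᶠ-correct {fourD} {(numeral 2 ^ᶠ fourD) *ᶠ (numeral 1 +ᶠ (fourD *ᶠ numeral 3))} {t} four
          (*ᶠ-correct {numeral 2 ^ᶠ fourD} {numeral 1 +ᶠ (fourD *ᶠ numeral 3)} {t}
            (^ᶠ-correct {numeral 2} {fourD} {t} {2} refl four)
            (+ᶠ-correct {numeral 1} {fourD *ᶠ numeral 3} {t} {1} refl
              (*ᶠ-correct {fourD} {numeral 3} {t} {4 * m} {3} four refl))))

  rescale : ∀ d n {t} → t ≤ w * (suc (kernelBound d) ^ suc (kernelBound d) * suc n) ^ e →
    t ≤ coefficient d * suc n ^ e
  rescale d n {t} t≤ = begin
    t                         ≤⟨ t≤ ⟩
    w * (X * suc n) ^ e       ≡⟨ cong (w *_) (^-distrib-* e X (suc n)) ⟩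
    w * (X ^ e * suc n ^ e)   ≡⟨ *-assoc w (X ^ e) (suc n ^ e) ⟨
    coefficient d * suc n ^ e ∎
    where
    open ≤-Reasoning
    X = suc (kernelBound d) ^ suc (kernelBound d)

-- Abstract, since unification would otherwise unfold these large numbers.
abstract
  polynomial-time : ∃[ W ] ∃[ E ] (∀ {N} .{{_ : NonZero N}} t → Small N antiPathCover t →
    time antiPathCover t ≤ W * N ^ E)
  polynomial-time = weight antiPathCover , foldCount antiPathCover , time≤weight*N^foldCount antiPathCover

timeFactor timeExponent : ℕ
timeFactor = proj₁ polynomial-time
timeExponent = proj₁ (proj₂ polynomial-time)

module _ (i : GraphAndNumber) where

  open GraphAndNumber i
  open Core graph using (kernelVertices; accepts; antiPathCoverᵉ)

  -- Used with two values of `m`: the time bound takes `suc (kernelBound d)`, and correctness, which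
  -- has to hold without any knowledge of d, takes `suc (length kernelVertices)`.
  evaluates : ∀ m → length kernelVertices < m →
    Evaluates (m ^ m * suc n) antiPathCover (encodeGraph graph ∙ encodeℕ k) (encodeBool (accepts k))
  evaluates m@(suc _) l = antiPathCoverᵉ {N = m ^ m * suc n}
    (≤-trans (n≤1+n n) (m≤n*m (suc n) (m ^ m) {{m^n≢0 m m}}))
    (λ j≤ → ≤-trans (^-bound l j≤) (m≤m*n (m ^ m) (suc n))) k

  time-fpt : ∀ d → HasTreeDepth graph d →
    time antiPathCover (encodeGraph graph ∙ encodeℕ k) ≤ coefficient timeFactor timeExponent d * suc n ^ timeExponent
  time-fpt d h = rescale timeFactor timeExponent d n
    (proj₂ (proj₂ polynomial-time) {{m*n≢0 (m ^ m) (suc n) {{m^n≢0 m m}}}} (encodeGraph graph ∙ encodeℕ k)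
      (Evaluates.small (evaluates m (s≤s (kernel-bound graph h)))))
    where m = suc (kernelBound d)

  computes-accepts : Computes run antiPathCover 0 on encodeGraph graph ∙ encodeℕ k
    inTime time antiPathCover (encodeGraph graph ∙ encodeℕ k) output encodeBool (accepts k)
  computes-accepts =
    subst (λ v → Computes run antiPathCover 0 on encodeGraph graph ∙ encodeℕ k
                   inTime time antiPathCover (encodeGraph graph ∙ encodeℕ k) output v)
      (Evaluates.value (evaluates (suc (length kernelVertices)) ≤-refl))
      (computes antiPathCover (encodeGraph graph ∙ encodeℕ k))

theorem4 : FixedParameterTractable AntiPathCoverByTreeDepth
theorem4 = run antiPathCover 0 , coefficient timeFactor timeExponent , timeExponent ,
  coefficient-computable timeFactor timeExponent , λ i →
  let open GraphAndNumber i
  in time antiPathCover (encodeGraph graph ∙ encodeℕ k) , Core.accepts graph k ,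
     computes-accepts i , accepts-correct graph k , time-fpt i
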